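{- Let $n\ge 3$ and let $P_n(x)=x^n+a_{n-2}x^{n-2}+\cdots+a_1x+a_0$ be a real monic polynomial whose coefficient of $x^{n-1}$ is zero. For $2\le i\le n$ let $P_i=\frac{i!}{n!}P_n^{(n-i)}$, so that $P_{i-1}=\frac1iP_i'$ for $3\le i\le n$, each $P_i$ is monic of degree $i$ with zero coefficient of $x^{i-1}$, and the constant term of $P_i$ is $b_i=\frac{i!\,(n-i)!}{n!}\,a_{n-i}$. For $3\le i\le n$ define $R_{i-2}$ by $P_i(x)=xP_{i-1}(x)-R_{i-2}(x)$ and put $R^0_{i-2}=R_{i-2}+b_i$ (a polynomial not depending on $b_i$). Then $P_n$ has $n$ distinct real roots if and only if $a_{n-2}<0$ and, for every $i\in\{3,\dots,n\}$ (where, inductively, $P_{i-1}$ has $i-1$ distinct real roots $\alpha^{(i-1)}_1<\cdots<\alpha^{(i-1)}_{i-1}$): - if $i$ is even, $$\max_{k\in\{1,\dots,\frac{i-2}{2}\}}R^0_{i-2}\big(\alpha^{(i-1)}_{2k}\big)<b_i<\min_{k\in\{0,\dots,\frac{i-2}{2}\}}R^0_{i-2}\big(\alpha^{(i-1)}_{2k+1}\big);$$ - if $i$ is odd, $$\max_{k\in\{0,\dots,\frac{i-3}{2}\}}R^0_{i-2}\big(\alpha^{(i-1)}_{2k+1}\big)<b_i<\min_{k\in\{1,\dots,\frac{i-1}{2}\}}R^0_{i-2}\big(\alpha^{(i-1)}_{2k}\big).$$ (In particular each of these open intervals is nonempty.)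
   Context: $P_n^{(m)}$ denotes the $m$-th derivative. The condition $a_{n-2}<0$ is equivalent to $P_2(x)=x^2+\frac{2(n-2)!}{n!}a_{n-2}$ having two distinct real roots. $R_{i-2}(x)=xP_{i-1}(x)-P_i(x)$ has constant term $-b_i$, and $R^0_{i-2}$ is $R_{i-2}$ with its constant term removed. -}

module Defs where

open import Algebra.Apartness.Bundles using (HeytingField)
open import Algebra.Bundles using (CommutativeRing)
open import Algebra.Core using (Op₂)
import Algebra.Definitions.RawMonoid as RawMonoidDefinitions
import Algebra.Properties.Ring as RingProperties
open import Data.Fin.Base using (Fin)
open import Data.List.Base using (List; []; _∷_; map)
open import Data.Nat.Base as ℕ using (ℕ; zero; suc; _∸_; _!; NonZero)
open import Data.Nat.Divisibility using (_∣_; _∤_)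
open import Data.Nat.Properties using (_!≢0)
open import Data.Product.Base using (∃; ∃-syntax; _×_; _,_; proj₁)
open import Data.Sum.Base using (_⊎_; inj₁; inj₂)
open import Function.Bundles using (_⇔_; Equivalence)
open import Level using (Level; _⊔_)
open import Relation.Binary.Core using (Rel)
open import Relation.Binary.Lattice.Definitions using (Supremum; Infimum)
open import Relation.Binary.PropositionalEquality.Core using (_≢_)
open import Relation.Binary.Structures using (IsStrictPartialOrder)
open import Relation.Nullary.Negation using (¬_)

-- The real numbers, axiomatised as a Cauchy-complete Archimedean ordered field.
-- Classically ℝ is the only such field up to isomorphism.  The axioms are the
-- constructive ones (no trichotomy), so constructive Cauchy reals qualify too.
record Reals (c ℓ₁ ℓ₂ : Level) : Set (Level.suc (c ⊔ ℓ₁ ⊔ ℓ₂)) where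
  infix 4 _<_ _≤_

  field
    heytingField : HeytingField c ℓ₁ ℓ₂

  open HeytingField heytingField public

  field
    _<_                  : Rel Carrier ℓ₂
    isStrictPartialOrder : IsStrictPartialOrder _≈_ _<_
    #⇔<⊎>                : ∀ x y → x # y ⇔ (x < y ⊎ y < x)
    +-monoˡ-<            : ∀ {x y} z → x < y → x + z < y + z
    *-pos                : ∀ {x y} → 0# < x → 0# < y → 0# < x * y

  _≤_ : Rel Carrier ℓ₂
  x ≤ y = ¬ (y < x)

  commutativeRing : CommutativeRing c ℓ₁
  commutativeRing = record { isCommutativeRing = isCommutativeRing }

  open CommutativeRing commutativeRing public using (ring; +-rawMonoid)
  open RawMonoidDefinitions +-rawMonoid public using () renaming (_×_ to _·_)

  fromℕ : ℕ → Carrier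
  fromℕ k = k · 1#

  field
    max min     : Op₂ Carrier
    max-sup     : Supremum _≤_ max
    min-inf     : Infimum _≤_ min
    archimedean : ∀ x → ∃[ k ] x < fromℕ k

  abs : Carrier → Carrier
  abs x = max x (- x)

  IsCauchy : (ℕ → Carrier) → Set (c ⊔ ℓ₂)
  IsCauchy s = ∀ ε → 0# < ε →
    ∃[ N ] (∀ j k → N ℕ.≤ j → N ℕ.≤ k → abs (s j - s k) < ε)

  _ConvergesTo_ : (ℕ → Carrier) → Carrier → Set (c ⊔ ℓ₂)
  s ConvergesTo l = ∀ ε → 0# < ε →
    ∃[ N ] (∀ j → N ℕ.≤ j → abs (s j - l) < ε)

  field
    complete : ∀ s → IsCauchy s → ∃[ l ] s ConvergesTo l

module RealPolynomials {c ℓ₁ ℓ₂} (ℝ : Reals c ℓ₁ ℓ₂) where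
  open Reals ℝ
  open RingProperties ring using (-‿distribʳ-*; -‿involutive)

  private
    module <-order = IsStrictPartialOrder isStrictPartialOrder

    0<1 : 0# < 1#
    0<1 with Equivalence.to (#⇔<⊎> 1# 0#)
               (invertible⇒# (1# , 1*[1-0]≈1 , trans (*-comm _ _) 1*[1-0]≈1))
      where
      1*[1-0]≈1 : 1# * (1# - 0#) ≈ 1#
      1*[1-0]≈1 = trans (*-identityˡ _)
        (trans (+-congˡ (trans (sym (+-identityˡ _)) (-‿inverseʳ 0#))) (+-identityʳ 1#))
    ... | inj₂ 0<1 = 0<1
    ... | inj₁ 1<0 = <-order.<-respʳ-≈ [-1]²≈1 (*-pos 0<-1 0<-1)
      where
      0<-1 : 0# < - 1#
      0<-1 = <-order.<-respʳ-≈ (+-identityˡ _)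
        (<-order.<-respˡ-≈ (-‿inverseʳ 1#) (+-monoˡ-< (- 1#) 1<0))
      [-1]²≈1 : - 1# * - 1# ≈ 1#
      [-1]²≈1 = trans (sym (-‿distribʳ-* _ _))
        (trans (-‿cong (*-identityʳ _)) (-‿involutive 1#))

  fromℕ-pos : ∀ k .{{_ : NonZero k}} → 0# < fromℕ k
  fromℕ-pos (suc zero)    = <-order.<-respʳ-≈ (sym (+-identityʳ 1#)) 0<1
  fromℕ-pos (suc (suc k)) = <-order.trans (fromℕ-pos (suc k))
    (<-order.<-respˡ-≈ (+-identityˡ _) (+-monoˡ-< (fromℕ (suc k)) 0<1))

  recip : ∀ {x} → x # 0# → Carrier
  recip x#0 = proj₁ (#⇒invertible x#0)

  infixl 7 _/ℕ_
  _/ℕ_ : Carrier → (k : ℕ) .{{_ : NonZero k}} → Carrier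
  x /ℕ k = x * recip (Equivalence.from (#⇔<⊎> (fromℕ k) 0#) (inj₂ (fromℕ-pos k)))

  -- Coefficient lists, constant term first; trailing zeros are allowed.
  Poly : Set c
  Poly = List Carrier

  coeff : Poly → ℕ → Carrier
  coeff []      _       = 0#
  coeff (x ∷ p) zero    = x
  coeff (x ∷ p) (suc j) = coeff p j

  eval : Poly → Carrier → Carrier
  eval []      x = 0#
  eval (a ∷ p) x = a + x * eval p x

  IsMonic : ℕ → Poly → Set ℓ₁
  IsMonic d p = coeff p d ≈ 1# × (∀ j → d ℕ.< j → coeff p j ≈ 0#)

  const : Carrier → Poly
  const a = a ∷ []

  X*_ : Poly → Poly
  X* p = 0# ∷ p

  scale : Carrier → Poly → Poly
  scale a = map (a *_)

  infixl 6 _⊕_ _⊖_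
  _⊕_ : Poly → Poly → Poly
  []      ⊕ q       = q
  (a ∷ p) ⊕ []      = a ∷ p
  (a ∷ p) ⊕ (b ∷ q) = (a + b) ∷ (p ⊕ q)

  _⊖_ : Poly → Poly → Poly
  p ⊖ q = p ⊕ map -_ q

  deriv : Poly → Poly
  deriv []      = []
  deriv (_ ∷ p) = go 1 p
    where
    go : ℕ → Poly → Poly
    go k []      = []
    go k (a ∷ q) = (k · a) ∷ go (suc k) q

  infix 9 _⁽_⁾
  _⁽_⁾ : Poly → ℕ → Poly
  p ⁽ zero ⁾  = p
  p ⁽ suc m ⁾ = deriv (p ⁽ m ⁾)

  HasDistinctRoots : ℕ → Poly → Set (c ⊔ ℓ₁ ⊔ ℓ₂)
  HasDistinctRoots m p = ∃ λ (α : Fin m → Carrier) →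
    (∀ j → eval p (α j) ≈ 0#) × (∀ j k → j ≢ k → α j # α k)

  -- α 1 < ⋯ < α m are roots of p; the values of α outside 1, …, m are irrelevant.
  OrderedRoots : ℕ → Poly → (ℕ → Carrier) → Set (ℓ₁ ⊔ ℓ₂)
  OrderedRoots m p α =
    (∀ k → 1 ℕ.≤ k → k ℕ.≤ m → eval p (α k) ≈ 0#) ×
    (∀ k → 1 ℕ.≤ k → k ℕ.< m → α k < α (suc k))

  -- foldRange _∙_ lo d f = f lo ∙ f (lo + 1) ∙ ⋯ ∙ f (lo + d)
  foldRange : Op₂ Carrier → ℕ → ℕ → (ℕ → Carrier) → Carrier
  foldRange _∙_ lo zero    f = f lo
  foldRange _∙_ lo (suc d) f = f lo ∙ foldRange _∙_ (suc lo) d f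

  -- Maximum and minimum of f over {lo, …, hi}, for lo ≤ hi.
  max[_⋯_] min[_⋯_] : ℕ → ℕ → (ℕ → Carrier) → Carrier
  max[ lo ⋯ hi ] = foldRange max lo (hi ∸ lo)
  min[ lo ⋯ hi ] = foldRange min lo (hi ∸ lo)

  module _ (n : ℕ) (Pₙ : Poly) where
    private instance
      n!≢0 : NonZero (n !)
      n!≢0 = n !≢0

    P : ℕ → Poly
    P i = scale (fromℕ (i !) /ℕ (n !)) (Pₙ ⁽ n ∸ i ⁾)

    b : ℕ → Carrier
    b i = fromℕ (i ! ℕ.* (n ∸ i) !) /ℕ (n !) * coeff Pₙ (n ∸ i)

    R R⁰ : ℕ → Poly
    R j  = (X* P (suc j)) ⊖ P (suc (suc j))
    R⁰ j = R j ⊕ const (b (suc (suc j)))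

    -- Q relates the two endpoints of the interval prescribed for b i, where α
    -- lists the roots of P (i ∸ 1).
    Endpoints : ∀ {q} → Rel Carrier q → ℕ → (ℕ → Carrier) → Set q
    Endpoints Q i α =
      (2 ∣ i → Q (max[ 1 ⋯ (i ∸ 2) ℕ./ 2 ] (λ k → R⁰ᵢ (α (2 ℕ.* k))))
                 (min[ 0 ⋯ (i ∸ 2) ℕ./ 2 ] (λ k → R⁰ᵢ (α (2 ℕ.* k ℕ.+ 1))))) ×
      (2 ∤ i → Q (max[ 0 ⋯ (i ∸ 3) ℕ./ 2 ] (λ k → R⁰ᵢ (α (2 ℕ.* k ℕ.+ 1))))
                 (min[ 1 ⋯ (i ∸ 1) ℕ./ 2 ] (λ k → R⁰ᵢ (α (2 ℕ.* k)))))
      where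
      R⁰ᵢ : Carrier → Carrier
      R⁰ᵢ = eval (R⁰ (i ∸ 2))

    Condition : ℕ → Set (c ⊔ ℓ₁ ⊔ ℓ₂)
    Condition i = ∀ α → OrderedRoots (i ∸ 1) (P (i ∸ 1)) α →
      Endpoints (λ l u → l < b i × b i < u) i α

    NonemptyInterval : ℕ → Set (c ⊔ ℓ₁ ⊔ ℓ₂)
    NonemptyInterval i = ∀ α → OrderedRoots (i ∸ 1) (P (i ∸ 1)) α →
      Endpoints (λ l u → ∃[ x ] (l < x × x < u)) i α

{-# OPTIONS --safe #-}

-- P_{i-1} is a multiple of P_i′, and on its roots P_i = b_i - R⁰_{i-2}.  So the
-- inequalities for b_i say that P_i has alternating signs at the roots of P_{i-1},
-- and by the intermediate value theorem this gives i real roots.  Conversely, by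
-- Rolle's theorem the roots of P_{i-1} separate those of P_i, which forces these
-- signs; for i = 2 the sign condition at the root 0 of P_1 is a_{n-2} < 0.
--
-- Constructively an exact zero exists in the intermediate value theorem because a
-- polynomial with invertible leading coefficient is apart from 0 somewhere in every
-- interval, which makes bisection possible; and two increasing enumerations of m
-- roots agree since otherwise they could be spliced into m + 1 distinct roots.
module Submission where

open import Defs
open import Algebra.Bundles using (CommutativeRing)
import Algebra.Apartness.Properties.HeytingCommutativeRing as HeytingProperties
import Algebra.Properties.CommutativeSemigroup as CommutativeSemigroupProperties
import Algebra.Properties.Group as GroupProperties
import Algebra.Properties.Ring as RingProperties
import Algebra.Properties.Semiring.Mult.TCOptimised as SemiringMult
import Algebra.Solver.Ring as RingSolver
open import Algebra.Solver.Ring.AlmostCommutativeRing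
  using (fromCommutativeRing; _-Raw-AlmostCommutative⟶_)
open import Data.Empty using (⊥-elim)
open import Data.Fin.Base as Fin using (Fin)
import Data.Fin.Properties as Fin
open import Data.Integer.Base as ℤ using (ℤ; -[1+_]; _⊖_)
import Data.Integer.Properties as ℤ
open import Data.List.Base using ([]; _∷_; map)
open import Data.Maybe.Base using (Maybe; just; nothing)
open import Data.Nat as ℕ using (ℕ; zero; suc; _∸_; _!; z≤n; s≤s)
open import Data.Nat.Divisibility using (_∣_; _∤_; divides; ∣m+n∣m⇒∣n; ∣1⇒≡1; m∣m*n)
open import Data.Nat.DivMod using (m*n/n≡m)
import Data.Nat.Properties as ℕ
open import Data.Product using (_×_; ∃-syntax; _,_; proj₁; proj₂)
open import Data.Sum using (_⊎_; inj₁; inj₂; [_,_]′)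
open import Function.Base using (_∘_; id)
open import Function.Bundles using (_⇔_; Equivalence; mk⇔)
open import Level using (_⊔_)
open import Relation.Binary.Definitions using (tri<; tri≈; tri>)
open import Relation.Binary.PropositionalEquality as ≡ using (_≡_)
import Relation.Binary.Reasoning.Setoid as SetoidReasoning
open import Relation.Binary.Structures using (IsStrictPartialOrder)
open import Relation.Nullary.Decidable.Core using (yes; no)
open import Relation.Nullary.Negation using (¬_; contradiction)

-- Rolle's theorem is obtained without extrema or mean values. Dividing `p` by `x - β 0`, where
-- `β 0` is its smallest root, leaves a quotient of one degree less with the remaining roots. This
-- induction yields the sign of `p` between its roots and the sign of `deriv p` at them, and the
-- intermediate value theorem for `deriv p` does the rest. Differentiation destroys monicity but
-- keeps the leading coefficient positive, so the auxiliary lemmas work with `HasPosLead` instead of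
-- `IsMonic`. Both implications meet in `SignCondition m`, which fixes the sign of `P (suc m)` at
-- the roots of `P m`. Like `Condition`, it speaks of every increasing enumeration of those roots,
-- whereas Rolle's theorem produces one particular enumeration: hence the need for uniqueness. Signs
-- are written `0# < sgn j * y`, so that parity enters only when the maxima and minima of the
-- statement are unfolded.

module IntegerCoefficients {c ℓ} (R : CommutativeRing c ℓ) where
  open CommutativeRing R
  open RingProperties ring
  open GroupProperties +-group using (ε⁻¹≈ε)
  open SemiringMult semiring renaming (_×_ to _·_)
  open CommutativeSemigroupProperties +-commutativeSemigroup using (interchange)
  open SetoidReasoning setoid

  -- With the type-checking-optimised multiple, `1 · 1#` reduces to `1#` and `3 · 1#` to
  -- `1# + 1# + 1#`, so `con (ℤ.+ 3)` in a solver call matches the numeral as it is written in the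
  -- goal.
  fromℤ : ℤ → Carrier
  fromℤ (ℤ.+ m)   = m · 1#
  fromℤ -[1+ m ] = - (suc m · 1#)

  fromℤ-⊖ : ∀ m n → fromℤ (m ⊖ n) ≈ m · 1# - n · 1#
  fromℤ-⊖ m zero = sym (trans (+-congˡ ε⁻¹≈ε) (+-identityʳ _))
  fromℤ-⊖ zero (suc n) = sym (+-identityˡ _)
  fromℤ-⊖ (suc m) (suc n) = begin
    fromℤ (suc m ⊖ suc n)               ≡⟨ ≡.cong fromℤ (ℤ.[1+m]⊖[1+n]≡m⊖n m n) ⟩
    fromℤ (m ⊖ n)                       ≈⟨ fromℤ-⊖ m n ⟩
    m · 1# - n · 1#                     ≈⟨ +-identityˡ _ ⟨
    0# + (m · 1# - n · 1#)              ≈⟨ +-congʳ (-‿inverseʳ 1#) ⟨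
    1# - 1# + (m · 1# - n · 1#)         ≈⟨ interchange _ _ _ _ ⟩
    1# + m · 1# + (- 1# - n · 1#)       ≈⟨ +-congˡ (-‿+-comm 1# (n · 1#)) ⟩
    1# + m · 1# - (1# + n · 1#)         ≈⟨ +-cong (1+× m 1#) (-‿cong (1+× n 1#)) ⟨
    suc m · 1# - suc n · 1#             ∎

  fromℤ-neg : ∀ i → fromℤ (ℤ.- i) ≈ - fromℤ i
  fromℤ-neg (ℤ.+ zero)  = sym ε⁻¹≈ε
  fromℤ-neg (ℤ.+ suc m) = refl
  fromℤ-neg -[1+ m ]   = sym (-‿involutive _)

  fromℤ-+ : ∀ i j → fromℤ (i ℤ.+ j) ≈ fromℤ i + fromℤ j
  fromℤ-+ (ℤ.+ m)  (ℤ.+ n)  = ×-homo-+ 1# m n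
  fromℤ-+ (ℤ.+ m)  -[1+ n ] = fromℤ-⊖ m (suc n)
  fromℤ-+ -[1+ m ] (ℤ.+ n)  = trans (fromℤ-⊖ n (suc m)) (+-comm _ _)
  fromℤ-+ -[1+ m ] -[1+ n ] = begin
    - (suc (suc (m ℕ.+ n)) · 1#)        ≡⟨ ≡.cong (λ k → - (k · 1#)) (ℕ.+-suc (suc m) n) ⟨
    - ((suc m ℕ.+ suc n) · 1#)          ≈⟨ -‿cong (×-homo-+ 1# (suc m) (suc n)) ⟩
    - (suc m · 1# + suc n · 1#)         ≈⟨ -‿+-comm _ _ ⟨
    - (suc m · 1#) - suc n · 1#         ∎

  fromℤ-*-pos : ∀ m j → fromℤ (ℤ.+ m ℤ.* j) ≈ fromℤ (ℤ.+ m) * fromℤ j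
  fromℤ-*-pos zero j = sym (zeroˡ _)
  fromℤ-*-pos (suc m) j = begin
    fromℤ (ℤ.+ suc m ℤ.* j)                 ≡⟨ ≡.cong fromℤ (ℤ.suc-* (ℤ.+ m) j) ⟩
    fromℤ (j ℤ.+ ℤ.+ m ℤ.* j)               ≈⟨ fromℤ-+ j (ℤ.+ m ℤ.* j) ⟩
    fromℤ j + fromℤ (ℤ.+ m ℤ.* j)           ≈⟨ +-cong (*-identityˡ _) (sym (fromℤ-*-pos m j)) ⟨
    1# * fromℤ j + m · 1# * fromℤ j        ≈⟨ distribʳ _ _ _ ⟨
    (1# + m · 1#) * fromℤ j                ≈⟨ *-congʳ (1+× m 1#) ⟨
    suc m · 1# * fromℤ j                   ∎

  fromℤ-* : ∀ i j → fromℤ (i ℤ.* j) ≈ fromℤ i * fromℤ j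
  fromℤ-* (ℤ.+ m) j = fromℤ-*-pos m j
  fromℤ-* -[1+ m ] j = begin
    fromℤ (-[1+ m ] ℤ.* j)          ≡⟨ ≡.cong fromℤ (ℤ.neg-distribˡ-* (ℤ.+ suc m) j) ⟨
    fromℤ (ℤ.- (ℤ.+ suc m ℤ.* j))    ≈⟨ fromℤ-neg (ℤ.+ suc m ℤ.* j) ⟩
    - fromℤ (ℤ.+ suc m ℤ.* j)       ≈⟨ -‿cong (fromℤ-*-pos (suc m) j) ⟩
    - (suc m · 1# * fromℤ j)       ≈⟨ -‿distribˡ-* _ _ ⟩
    - (suc m · 1#) * fromℤ j       ∎

  morphism : ℤ.+-*-rawRing -Raw-AlmostCommutative⟶ fromCommutativeRing R
  morphism = record
    { ⟦_⟧    = fromℤ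
    ; +-homo = fromℤ-+
    ; *-homo = fromℤ-*
    ; -‿homo = fromℤ-neg
    ; 0-homo = refl
    ; 1-homo = refl
    }

  -- Equality of reals is undecidable, so the solver compares coefficients as integers; `nothing`
  -- claims no inequality.
  fromℤ≟ : ∀ i j → Maybe (fromℤ i ≈ fromℤ j)
  fromℤ≟ i j with i ℤ.≟ j
  ... | yes i≡j = just (reflexive (≡.cong fromℤ i≡j))
  ... | no  _   = nothing

  open RingSolver ℤ.+-*-rawRing (fromCommutativeRing R) morphism fromℤ≟ public
    using (solve; _:=_; _:+_; _:*_; _:-_; :-_; con)

-- Ordered field arithmetic without trichotomy.

module Order {c ℓ₁ ℓ₂} (ℝ : Reals c ℓ₁ ℓ₂) where
  open Reals ℝ
  open IntegerCoefficients commutativeRing public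
    using (solve; _:=_; _:+_; _:*_; _:-_; :-_; con)
  open IsStrictPartialOrder isStrictPartialOrder public using (<-respʳ-≈; <-respˡ-≈)
    renaming (irrefl to <-irrefl; trans to <-trans; asym to <-asym)
  open HeytingProperties heytingCommutativeRing public
    using (1#0; x#0y#0→xy#0; #-congʳ; invertibleˡ⇒#)

  x<y⇒0<y-x : ∀ {x y} → x < y → 0# < y - x
  x<y⇒0<y-x {x} x<y = <-respˡ-≈ (-‿inverseʳ x) (+-monoˡ-< (- x) x<y)

  0<y-x⇒x<y : ∀ {x y} → 0# < y - x → x < y
  0<y-x⇒x<y {x} {y} 0<y-x =
    <-respʳ-≈ (solve 2 (λ x y → y :- x :+ x := y) refl x y)
      (<-respˡ-≈ (+-identityˡ x) (+-monoˡ-< x 0<y-x))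

  <-from : ∀ {x y d} → 0# < d → d ≈ y - x → x < y
  <-from 0<d d≈y-x = 0<y-x⇒x<y (<-respʳ-≈ d≈y-x 0<d)

  +-pos : ∀ {x y} → 0# < x → 0# < y → 0# < x + y
  +-pos {x} {y} 0<x 0<y = <-trans 0<y (<-respˡ-≈ (+-identityˡ y) (+-monoˡ-< y 0<x))

  neg-pos : ∀ {x} → x < 0# → 0# < - x
  neg-pos {x} x<0 = <-respʳ-≈ (+-identityˡ (- x)) (x<y⇒0<y-x x<0)

  pos-neg : ∀ {x} → 0# < - x → x < 0#
  pos-neg {x} 0<-x = <-from 0<-x (sym (+-identityˡ (- x)))

  #⇒<⊎> : ∀ {x y} → x # y → x < y ⊎ y < x
  #⇒<⊎> = Equivalence.to (#⇔<⊎> _ _)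

  <⇒# : ∀ {x y} → x < y → x # y
  <⇒# = Equivalence.from (#⇔<⊎> _ _) ∘ inj₁

  >⇒# : ∀ {x y} → y < x → x # y
  >⇒# = Equivalence.from (#⇔<⊎> _ _) ∘ inj₂

  0<1 : 0# < 1#
  0<1 with #⇒<⊎> 1#0
  ... | inj₁ 1<0 = <-respʳ-≈ (solve 0 (:- con (ℤ.+ 1) :* :- con (ℤ.+ 1) := con (ℤ.+ 1)) refl)
                     (*-pos (neg-pos 1<0) (neg-pos 1<0))
  ... | inj₂ 0<1 = 0<1

  0<2 : 0# < 1# + 1#
  0<2 = +-pos 0<1 0<1

  -- The substitute for trichotomy: cotransitivity of apartness separates `z` from `x` or from `y`,
  -- and transitivity handles a `z` outside the interval.
  <-cotrans : ∀ {x y} → x < y → ∀ z → x < z ⊎ z < y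
  <-cotrans x<y z with #-cotrans (<⇒# x<y) z
  ... | inj₁ x#z = [ inj₁ , (λ z<x → inj₂ (<-trans z<x x<y)) ]′ (#⇒<⊎> x#z)
  ... | inj₂ z#y = [ inj₂ , (λ y<z → inj₁ (<-trans x<y y<z)) ]′ (#⇒<⊎> z#y)

  <⇒≤ : ∀ {x y} → x < y → x ≤ y
  <⇒≤ = <-asym

  ≈⇒≤ : ∀ {x y} → x ≈ y → x ≤ y
  ≈⇒≤ x≈y = <-irrefl (sym x≈y)

  ≤-trans : ∀ {x y z} → x ≤ y → y ≤ z → x ≤ z
  ≤-trans {y = y} x≤y y≤z z<x = [ y≤z , x≤y ]′ (<-cotrans z<x y)

  ≤-<-trans : ∀ {x y z} → x ≤ y → y < z → x < z
  ≤-<-trans {x} x≤y y<z = [ (λ y<x → contradiction y<x x≤y) , id ]′ (<-cotrans y<z x)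

  <-≤-trans : ∀ {x y z} → x < y → y ≤ z → x < z
  <-≤-trans {z = z} x<y y≤z = [ id , (λ z<y → contradiction z<y y≤z) ]′ (<-cotrans x<y z)

  ≤-antisym : ∀ {x y} → x ≤ y → y ≤ x → x ≈ y
  ≤-antisym x≤y y≤x = proj₁ (tight _ _) λ x#y → [ y≤x , x≤y ]′ (#⇒<⊎> x#y)

  #∧≤⇒< : ∀ {x y} → x # y → x ≤ y → x < y
  #∧≤⇒< x#y x≤y = [ id , (λ y<x → contradiction y<x x≤y) ]′ (#⇒<⊎> x#y)

  inverse : ∀ {x} → x # 0# → ∃[ r ] r * x ≈ 1#
  inverse {x} x#0 with #⇒invertible x#0
  ... | r , r*[x-0]≈1 , _ = r , trans (solve 2 (λ r x → r :* x := r :* (x :- con (ℤ.+ 0))) refl r x) r*[x-0]≈1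

  -- If `r` inverts `x * y`, then `r * x` inverts `y`.
  *#0⇒#0ʳ : ∀ {x y} → x * y # 0# → y # 0#
  *#0⇒#0ʳ {x} {y} xy#0 = invertibleˡ⇒# (proj₁ (inverse xy#0) * x ,
    trans (regroup (proj₁ (inverse xy#0)) x y) (proj₂ (inverse xy#0)))
    where
    regroup : ∀ r x y → r * x * (y - 0#) ≈ r * (x * y)
    regroup = solve 3 (λ r x y → r :* x :* (y :- con (ℤ.+ 0)) := r :* (x :* y)) refl

  x*-y≈-xy : ∀ x y → x * - y ≈ - (x * y)
  x*-y≈-xy = solve 2 (λ x y → x :* :- y := :- (x :* y)) refl

  -- A positive product makes `y` apart from 0, so its sign can be decided, and `y < 0` would make
  -- the product negative.
  *-cancelˡ-pos : ∀ {x y} → 0# < x → 0# < x * y → 0# < y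
  *-cancelˡ-pos {x} {y} 0<x 0<xy =
    [ (λ y<0 → ⊥-elim (<-asym 0<xy (pos-neg {x * y} (0<-xy y<0)))) , id ]′
      (#⇒<⊎> (*#0⇒#0ʳ {x} {y} (>⇒# 0<xy)))
    where
    0<-xy : y < 0# → 0# < - (x * y)
    0<-xy y<0 = <-respʳ-≈ (x*-y≈-xy x y) (*-pos 0<x (neg-pos y<0))

  inverse-pos : ∀ {x} → 0# < x → ∃[ r ] (0# < r × r * x ≈ 1#)
  inverse-pos {x} 0<x = r , *-cancelˡ-pos 0<x (<-respʳ-≈ (trans (sym rx≈1) (*-comm r x)) 0<1) , rx≈1
    where
    r = proj₁ (inverse (>⇒# 0<x))
    rx≈1 = proj₂ (inverse (>⇒# 0<x))

  *≈0⇒≈0 : ∀ {x y} → x # 0# → x * y ≈ 0# → y ≈ 0#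
  *≈0⇒≈0 x#0 xy≈0 = proj₁ (tight _ _) λ y#0 → proj₂ (tight _ _) xy≈0 (x#0y#0→xy#0 x#0 y#0)

  x-y#0⇒x#y : ∀ {x y} → x - y # 0# → x # y
  x-y#0⇒x#y x-y#0 = invertibleˡ⇒# (inverse x-y#0)

  y≈x+y-x : ∀ x y → y ≈ x + y - x
  y≈x+y-x = solve 2 (λ x y → y := x :+ y :- x) refl

  x<x+1 : ∀ x → x < x + 1#
  x<x+1 x = <-from 0<1 (y≈x+y-x x 1#)

  x-y≈-[y-x] : ∀ x y → x - y ≈ - (y - x)
  x-y≈-[y-x] = solve 2 (λ x y → x :- y := :- (y :- x)) refl

  double-pos : ∀ {x} → 0# < x + x → 0# < x
  double-pos {x} 0<x+x = *-cancelˡ-pos 0<2 (<-respʳ-≈ (x+x≈2x x) 0<x+x)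
    where
    x+x≈2x : ∀ x → x + x ≈ (1# + 1#) * x
    x+x≈2x = solve 1 (λ x → x :+ x := con (ℤ.+ 2) :* x) refl

  midpoint : ∀ {x y} → x < y → ∃[ m ] (m + m ≈ x + y × x < m × m < y)
  midpoint {x} {y} x<y = m , m+m≈x+y , x<m , m<y
    where
    h = proj₁ (inverse-pos 0<2)
    h*2≈1 = proj₂ (proj₂ (inverse-pos 0<2))
    m = h * (x + y)
    expand : ∀ h s → h * s + h * s ≈ h * (1# + 1#) * s
    expand = solve 2 (λ h s → h :* s :+ h :* s := h :* con (ℤ.+ 2) :* s) refl
    m+m≈x+y : m + m ≈ x + y
    m+m≈x+y = trans (expand h (x + y)) (trans (*-congʳ h*2≈1) (*-identityˡ (x + y)))
    lower : ∀ x y → y - x ≈ x + y - (x + x)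
    lower = solve 2 (λ x y → y :- x := x :+ y :- (x :+ x)) refl
    lower′ : ∀ m x → m + m - (x + x) ≈ m - x + (m - x)
    lower′ = solve 2 (λ m x → m :+ m :- (x :+ x) := m :- x :+ (m :- x)) refl
    upper : ∀ x y → y - x ≈ y + y - (x + y)
    upper = solve 2 (λ x y → y :- x := y :+ y :- (x :+ y)) refl
    upper′ : ∀ m y → y + y - (m + m) ≈ y - m + (y - m)
    upper′ = solve 2 (λ m y → y :+ y :- (m :+ m) := y :- m :+ (y :- m)) refl
    0<y-x = x<y⇒0<y-x x<y
    x<m : x < m
    x<m = 0<y-x⇒x<y (double-pos (<-respʳ-≈
      (trans (lower x y) (trans (+-congʳ (sym m+m≈x+y)) (lower′ m x))) 0<y-x))
    m<y : m < y
    m<y = 0<y-x⇒x<y (double-pos (<-respʳ-≈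
      (trans (upper x y) (trans (+-congˡ (-‿cong (sym m+m≈x+y))) (upper′ m y))) 0<y-x))

  -- Since `(x + y) * e` is `x * y`, the product `(x + y) * (x - e)` equals the positive number
  -- `x * x`.
  *-below : ∀ {x y e} → 0# < x → 0# < y → (x + y) * e ≈ x * y → e < x
  *-below {x} {y} {e} 0<x 0<y [x+y]e≈xy =
    0<y-x⇒x<y (*-cancelˡ-pos (+-pos 0<x 0<y) (<-respʳ-≈ x²≈ (*-pos 0<x 0<x)))
    where
    x²-identity : ∀ x y → x * x ≈ (x + y) * x - x * y
    x²-identity = solve 2 (λ x y → x :* x := (x :+ y) :* x :- x :* y) refl
    distribute : ∀ s x e → s * x - s * e ≈ s * (x - e)
    distribute = solve 3 (λ s x e → s :* x :- s :* e := s :* (x :- e)) refl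
    x²≈ : x * x ≈ (x + y) * (x - e)
    x²≈ = trans (x²-identity x y)
      (trans (+-congˡ (-‿cong (sym [x+y]e≈xy))) (distribute (x + y) x e))

  -- The witness is x y / (x + y).
  positive-below : ∀ {x y} → 0# < x → 0# < y → ∃[ e ] (0# < e × e < x × e < y)
  positive-below {x} {y} 0<x 0<y = e , *-pos 0<r (*-pos 0<x 0<y)
    , *-below 0<x 0<y [x+y]e≈xy
    , *-below 0<y 0<x (trans (*-congʳ (+-comm y x)) (trans [x+y]e≈xy (*-comm x y)))
    where
    inv = inverse-pos (+-pos 0<x 0<y)
    r = proj₁ inv
    0<r = proj₁ (proj₂ inv)
    r[x+y]≈1 = proj₂ (proj₂ inv)
    e = r * (x * y)
    reassociate : ∀ r s p → s * (r * p) ≈ r * s * p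
    reassociate = solve 3 (λ r s p → s :* (r :* p) := r :* s :* p) refl
    [x+y]e≈xy : (x + y) * e ≈ x * y
    [x+y]e≈xy = trans (reassociate r (x + y) (x * y))
      (trans (*-congʳ r[x+y]≈1) (*-identityˡ (x * y)))

  x≤max : ∀ x y → x ≤ max x y
  x≤max x y = proj₁ (max-sup x y)

  y≤max : ∀ x y → y ≤ max x y
  y≤max x y = proj₁ (proj₂ (max-sup x y))

  min≤x : ∀ x y → min x y ≤ x
  min≤x x y = proj₁ (min-inf x y)

  min≤y : ∀ x y → min x y ≤ y
  min≤y x y = proj₁ (proj₂ (min-inf x y))

  -- The supremum axiom speaks only of the negative relation `≤`. Strictness is recovered by leaving
  -- room: both `x` and `y` stay below `z - e` for some positive `e`.
  max-< : ∀ {x y z} → x < z → y < z → max x y < z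
  max-< {x} {y} {z} x<z y<z =
    ≤-<-trans (proj₂ (proj₂ (max-sup x y)) (z - e) (<⇒≤ (below x e<z-x)) (<⇒≤ (below y e<z-y)))
      (<-from 0<e (solve 2 (λ z e → e := z :- (z :- e)) refl z e))
    where
    gap = positive-below (x<y⇒0<y-x x<z) (x<y⇒0<y-x y<z)
    e = proj₁ gap
    0<e = proj₁ (proj₂ gap)
    e<z-x = proj₁ (proj₂ (proj₂ gap))
    e<z-y = proj₂ (proj₂ (proj₂ gap))
    below : ∀ w → e < z - w → w < z - e
    below w e<z-w = <-from (x<y⇒0<y-x e<z-w) (solve 3 (λ z w e → z :- w :- e := z :- e :- w) refl z w e)

  <-min : ∀ {x y z} → z < x → z < y → z < min x y
  <-min {x} {y} {z} z<x z<y =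
    <-≤-trans (<-from 0<e (solve 2 (λ z e → e := z :+ e :- z) refl z e))
      (proj₂ (proj₂ (min-inf x y)) (z + e) (<⇒≤ (above x e<x-z)) (<⇒≤ (above y e<y-z)))
    where
    gap = positive-below (x<y⇒0<y-x z<x) (x<y⇒0<y-x z<y)
    e = proj₁ gap
    0<e = proj₁ (proj₂ gap)
    e<x-z = proj₁ (proj₂ (proj₂ gap))
    e<y-z = proj₂ (proj₂ (proj₂ gap))
    above : ∀ w → e < w - z → z + e < w
    above w e<w-z = <-from (x<y⇒0<y-x e<w-z) (solve 3 (λ z w e → w :- z :- e := w :- (z :+ e)) refl z w e)

  abs-< : ∀ {x e} → x < e → - x < e → abs x < e
  abs-< = max-<

  abs<⇒< : ∀ {x e} → abs x < e → x < e
  abs<⇒< {x} = ≤-<-trans (x≤max x (- x))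

  abs<⇒-< : ∀ {x e} → abs x < e → - x < e
  abs<⇒-< {x} = ≤-<-trans (y≤max x (- x))

-- Evaluation, synthetic division and derivatives of coefficient lists.

module PolynomialProperties {c ℓ₁ ℓ₂} (ℝ : Reals c ℓ₁ ℓ₂) where
  open Reals ℝ
  open RealPolynomials ℝ
  open Order ℝ

  Degree≤ : ℕ → Poly → Set ℓ₁
  Degree≤ d p = ∀ j → d ℕ.< j → coeff p j ≈ 0#

  tail-degree : ∀ {d c p} → Degree≤ (suc d) (c ∷ p) → Degree≤ d p
  tail-degree deg j d<j = deg (suc j) (s≤s d<j)

  *-zero-+ : ∀ {y} a x → y ≈ 0# → a + x * y ≈ a
  *-zero-+ a x y≈0 = trans (+-congˡ (trans (*-congˡ y≈0) (zeroʳ x))) (+-identityʳ a)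

  eval-cong : ∀ p {x y} → x ≈ y → eval p x ≈ eval p y
  eval-cong []      x≈y = refl
  eval-cong (a ∷ p) x≈y = +-congˡ (*-cong x≈y (eval-cong p x≈y))

  eval-zero : ∀ p x → (∀ j → coeff p j ≈ 0#) → eval p x ≈ 0#
  eval-zero []      x zeros = refl
  eval-zero (a ∷ p) x zeros = trans (*-zero-+ a x (eval-zero p x (zeros ∘ suc))) (zeros 0)

  eval-degree0 : ∀ p x → Degree≤ 0 p → eval p x ≈ coeff p 0
  eval-degree0 []      x deg = refl
  eval-degree0 (a ∷ p) x deg = *-zero-+ a x (eval-zero p x λ j → deg (suc j) (s≤s z≤n))

  eval-at-0 : ∀ p → eval p 0# ≈ coeff p 0
  eval-at-0 []      = refl
  eval-at-0 (a ∷ p) = trans (+-congˡ (zeroˡ _)) (+-identityʳ a)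

  coeff-scale : ∀ a p j → coeff (scale a p) j ≈ a * coeff p j
  coeff-scale a []      j       = sym (zeroʳ a)
  coeff-scale a (b ∷ p) zero    = refl
  coeff-scale a (b ∷ p) (suc j) = coeff-scale a p j

  eval-scale : ∀ a p x → eval (scale a p) x ≈ a * eval p x
  eval-scale a []      x = sym (zeroʳ a)
  eval-scale a (b ∷ p) x = trans (+-congˡ (*-congˡ (eval-scale a p x))) (distribute a b x (eval p x))
    where
    distribute : ∀ a b x y → a * b + x * (a * y) ≈ a * (b + x * y)
    distribute = solve 4 (λ a b x y → a :* b :+ x :* (a :* y) := a :* (b :+ x :* y)) refl

  horner-+ : ∀ a b x y z → a + b + x * (y + z) ≈ a + x * y + (b + x * z)
  horner-+ = solve 5 (λ a b x y z → a :+ b :+ x :* (y :+ z) := a :+ x :* y :+ (b :+ x :* z)) refl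

  eval-⊕ : ∀ p q x → eval (p ⊕ q) x ≈ eval p x + eval q x
  eval-⊕ []      q       x = sym (+-identityˡ _)
  eval-⊕ (a ∷ p) []      x = sym (+-identityʳ _)
  eval-⊕ (a ∷ p) (b ∷ q) x = trans (+-congˡ (*-congˡ (eval-⊕ p q x))) (horner-+ a b x (eval p x) (eval q x))

  eval-neg : ∀ p x → eval (map -_ p) x ≈ - eval p x
  eval-neg []      x = sym (solve 0 (:- con (ℤ.+ 0) := con (ℤ.+ 0)) refl)
  eval-neg (a ∷ p) x = trans (+-congˡ (*-congˡ (eval-neg p x))) (distribute a x (eval p x))
    where
    distribute : ∀ a x y → - a + x * - y ≈ - (a + x * y)
    distribute = solve 3 (λ a x y → :- a :+ x :* :- y := :- (a :+ x :* y)) refl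

  -- Synthetic division by `x - a`: the coefficients of the quotient are the intermediate Horner
  -- values, followed by a padding zero, and the remainder is `eval p a`.
  quot : Carrier → Poly → Poly
  quot a []      = []
  quot a (c ∷ p) = eval p a ∷ quot a p

  quot-eval : ∀ a p x → eval p x ≈ eval p a + (x - a) * eval (quot a p) x
  quot-eval a []      x = sym (*-zero-+ 0# (x - a) refl)
  quot-eval a (c ∷ p) x =
    trans (+-congˡ (*-congˡ (quot-eval a p x))) (regroup a c x (eval p a) (eval (quot a p) x))
    where
    regroup : ∀ a c x y z → c + x * (y + (x - a) * z) ≈ c + a * y + (x - a) * (y + x * z)
    regroup = solve 5 (λ a c x y z → c :+ x :* (y :+ (x :- a) :* z) :=
                                     c :+ a :* y :+ (x :- a) :* (y :+ x :* z)) refl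

  quot-coeff : ∀ a p d → Degree≤ (suc d) p → coeff (quot a p) d ≈ coeff p (suc d)
  quot-coeff a []      d       deg = refl
  quot-coeff a (c ∷ p) zero    deg = eval-degree0 p a (tail-degree deg)
  quot-coeff a (c ∷ p) (suc d) deg = quot-coeff a p d (tail-degree deg)

  quot-degree : ∀ a p d → Degree≤ (suc d) p → Degree≤ d (quot a p)
  quot-degree a p d deg j d<j = trans
    (quot-coeff a p j λ k 1+j<k → deg k (ℕ.<-trans (s≤s d<j) 1+j<k)) (deg (suc j) (s≤s d<j))

  quot-root : ∀ {a} p x → eval p a ≈ 0# → eval p x ≈ (x - a) * eval (quot a p) x
  quot-root {a} p x p[a]≈0 = trans (quot-eval a p x) (trans (+-congʳ p[a]≈0) (+-identityˡ _))

  quot-other-root : ∀ {a b} p → a < b → eval p a ≈ 0# → eval p b ≈ 0# → eval (quot a p) b ≈ 0#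
  quot-other-root {a} {b} p a<b p[a]≈0 p[b]≈0 =
    *≈0⇒≈0 (>⇒# (x<y⇒0<y-x a<b)) (trans (sym (quot-root p b p[a]≈0)) p[b]≈0)

  derivFrom : ℕ → Poly → Poly
  derivFrom k []      = []
  derivFrom k (a ∷ q) = (k · a) ∷ derivFrom (suc k) q

  -- The wildcard is the local function of deriv, which cannot be named from
  -- here; unification finds it at the use in deriv-∷.
  go≡derivFrom : ∀ (c : Carrier) (p : Poly) k q → _ ≡ derivFrom k q
  deriv-∷ : ∀ c p → deriv (c ∷ p) ≡ derivFrom 1 p
  deriv-∷ c []      = ≡.refl
  deriv-∷ c (a ∷ q) with 2 | a ∷ q
  ... | k | p = ≡.cong (_ ∷_) (go≡derivFrom c p k q)

  go≡derivFrom c p k []      = ≡.refl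
  go≡derivFrom c p k (a ∷ q) = ≡.cong (_ ∷_) (go≡derivFrom c p (suc k) q)

  ·-zero : ∀ k {x} → x ≈ 0# → k · x ≈ 0#
  ·-zero zero    x≈0 = refl
  ·-zero (suc k) x≈0 = trans (+-cong x≈0 (·-zero k x≈0)) (+-identityˡ 0#)

  coeff-derivFrom : ∀ k p j → coeff (derivFrom k p) j ≈ (k ℕ.+ j) · coeff p j
  coeff-derivFrom k []      j = sym (·-zero (k ℕ.+ j) refl)
  coeff-derivFrom k (a ∷ p) zero    = reflexive (≡.cong (_· a) (≡.sym (ℕ.+-identityʳ k)))
  coeff-derivFrom k (a ∷ p) (suc j) = trans (coeff-derivFrom (suc k) p j)
    (reflexive (≡.cong (_· coeff p j) (≡.sym (ℕ.+-suc k j))))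

  coeff-deriv : ∀ p j → coeff (deriv p) j ≈ suc j · coeff p (suc j)
  coeff-deriv []      j = sym (·-zero (suc j) refl)
  coeff-deriv (c ∷ p) j = trans (reflexive (≡.cong (λ q → coeff q j) (deriv-∷ c p)))
    (coeff-derivFrom 1 p j)

  eval-derivFrom-suc : ∀ k p x → eval (derivFrom (suc k) p) x ≈ eval p x + eval (derivFrom k p) x
  eval-derivFrom-suc k []      x = sym (+-identityˡ _)
  eval-derivFrom-suc k (a ∷ p) x = trans (+-congˡ (*-congˡ (eval-derivFrom-suc (suc k) p x)))
    (horner-+ a (k · a) x (eval p x) (eval (derivFrom (suc k) p) x))

  -- Counting from 0 multiplies the coefficient of degree `j` by `j`, which is the operator taking
  -- `p(x)` to `x p′(x)`.
  eval-derivFrom-0 : ∀ p x → eval (derivFrom 0 p) x ≈ x * eval (deriv p) x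
  eval-derivFrom-0 []      x = sym (zeroʳ x)
  eval-derivFrom-0 (a ∷ p) x = trans (+-identityˡ _)
    (*-congˡ (reflexive (≡.cong (λ q → eval q x) (≡.sym (deriv-∷ a p)))))

  -- The product rule for `c + x p(x)`.
  eval-deriv-∷ : ∀ c p x → eval (deriv (c ∷ p)) x ≈ eval p x + x * eval (deriv p) x
  eval-deriv-∷ c p x = trans (reflexive (≡.cong (λ q → eval q x) (deriv-∷ c p)))
    (trans (eval-derivFrom-suc 0 p x) (+-congˡ (eval-derivFrom-0 p x)))

  -- The product rule for p(x) = p(a) + (x - a) q(x), with q = quot a p.
  eval-deriv-quot : ∀ a p x →
    eval (deriv p) x ≈ eval (quot a p) x + (x - a) * eval (deriv (quot a p)) x
  eval-deriv-quot a []      x = sym (*-zero-+ 0# (x - a) refl)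
  eval-deriv-quot a (c ∷ p) x =
    trans (eval-deriv-∷ c p x)
    (trans (+-cong (quot-eval a p x) (*-congˡ (eval-deriv-quot a p x)))
    (trans (regroup a x (eval p a) (eval (quot a p) x) (eval (deriv (quot a p)) x))
    (+-congˡ (*-congˡ (sym (eval-deriv-∷ (eval p a) (quot a p) x))))))
    where
    regroup : ∀ a x y z w → y + (x - a) * z + x * (z + (x - a) * w) ≈ y + x * z + (x - a) * (z + x * w)
    regroup = solve 5 (λ a x y z w → y :+ (x :- a) :* z :+ x :* (z :+ (x :- a) :* w) :=
                                     y :+ x :* z :+ (x :- a) :* (z :+ x :* w)) refl

  ·-pos : ∀ k {x} → 0# < x → 0# < suc k · x
  ·-pos zero    0<x = <-respʳ-≈ (sym (+-identityʳ _)) 0<x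
  ·-pos (suc k) 0<x = +-pos 0<x (·-pos k 0<x)

-- Signs of a polynomial between its roots and of its derivative at them.

module Signs {c ℓ₁ ℓ₂} (ℝ : Reals c ℓ₁ ℓ₂) where
  open Reals ℝ
  open RealPolynomials ℝ
  open Order ℝ
  open PolynomialProperties ℝ

  -- The power `(-1)^j` as a real number, so that a sign claim is the positivity of a product.
  sgn : ℕ → Carrier
  sgn zero    = 1#
  sgn (suc j) = - sgn j

  HasPosLead : ℕ → Poly → Set _
  HasPosLead d p = Degree≤ d p × 0# < coeff p d

  Increasing : ℕ → (ℕ → Carrier) → Set _
  Increasing m β = ∀ {i j} → i ℕ.< j → j ℕ.< m → β i < β j

  -- Unlike in OrderedRoots, the roots are indexed from 0.
  IncreasingRoots : ℕ → Poly → (ℕ → Carrier) → Set _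
  IncreasingRoots m p β = (∀ {j} → j ℕ.< m → eval p (β j) ≈ 0#) × Increasing m β

  quot-lead : ∀ {d} p a → HasPosLead (suc d) p → HasPosLead d (quot a p)
  quot-lead {d} p a (deg , lead) =
    quot-degree a p d deg , <-respʳ-≈ (sym (quot-coeff a p d deg)) lead

  increasing-≤ : ∀ {m} β → Increasing m β → ∀ {i j} → i ℕ.≤ j → j ℕ.< m → β i ≤ β j
  increasing-≤ β β↗ i≤j j<m =
    [ (λ i<j → <⇒≤ (β↗ i<j j<m)) , (λ { ≡.refl → ≈⇒≤ refl }) ]′ (ℕ.m≤n⇒m<n∨m≡n i≤j)

  tail-increasing : ∀ {m β} → Increasing (suc m) β → Increasing m (β ∘ suc)
  tail-increasing β↗ i<j j<m = β↗ (s≤s i<j) (s≤s j<m)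

  quot-roots : ∀ {m} p β → IncreasingRoots (suc m) p β → IncreasingRoots m (quot (β 0) p) (β ∘ suc)
  quot-roots p β (root , β↗) =
    (λ j<m → quot-other-root p (β↗ (s≤s z≤n) (s≤s j<m)) (root (s≤s z≤n)) (root (s≤s j<m)))
    , tail-increasing {β = β} β↗

  sgn-above : ∀ s x b {y q} → y ≈ (x - b) * q → b < x → 0# < s * q → 0# < s * y
  sgn-above s x b {y} {q} y≈ b<x 0<sq = <-respʳ-≈
    (trans (regroup s (x - b) q) (*-congˡ (sym y≈))) (*-pos (x<y⇒0<y-x b<x) 0<sq)
    where
    regroup : ∀ s d q → d * (s * q) ≈ s * (d * q)
    regroup = solve 3 (λ s d q → d :* (s :* q) := s :* (d :* q)) refl

  sgn-below : ∀ s x b {y q} → y ≈ (x - b) * q → x < b → 0# < s * q → 0# < - s * y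
  sgn-below s x b {y} {q} y≈ x<b 0<sq = <-respʳ-≈
    (trans (regroup s x b q) (*-congˡ (sym y≈))) (*-pos (x<y⇒0<y-x x<b) 0<sq)
    where
    regroup : ∀ s x b q → (b - x) * (s * q) ≈ - s * ((x - b) * q)
    regroup = solve 4 (λ s x b q → (b :- x) :* (s :* q) := :- s :* ((x :- b) :* q)) refl

  -- Each of the `m - k` roots above `x` contributes one negative linear factor. The induction
  -- splits off the factor at `β 0`, which is negative for `k = 0` and positive otherwise.
  sign-between : ∀ m p β x k → HasPosLead m p → IncreasingRoots m p β → k ℕ.≤ m →
    (∀ j → j ℕ.< k → β j < x) → (∀ j → k ℕ.≤ j → j ℕ.< m → x < β j) →
    0# < sgn (m ∸ k) * eval p x
  sign-between zero p β x zero (deg , lead) _ _ _ _ =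
    <-respʳ-≈ (sym (trans (*-identityˡ _) (eval-degree0 p x deg))) lead
  sign-between (suc m) p β x zero lead roots _ _ above =
    sgn-below (sgn m) x (β 0) (quot-root p x (proj₁ roots (s≤s z≤n))) (above 0 z≤n (s≤s z≤n))
      (sign-between m (quot (β 0) p) (β ∘ suc) x 0 (quot-lead p (β 0) lead) (quot-roots p β roots) z≤n
        (λ _ ()) (λ j _ j<m → above (suc j) z≤n (s≤s j<m)))
  sign-between (suc m) p β x (suc k) lead roots (s≤s k≤m) below above =
    sgn-above (sgn (m ∸ k)) x (β 0) (quot-root p x (proj₁ roots (s≤s z≤n))) (below 0 (s≤s z≤n))
      (sign-between m (quot (β 0) p) (β ∘ suc) x k (quot-lead p (β 0) lead) (quot-roots p β roots) k≤m
        (λ j j<k → below (suc j) (s≤s j<k)) (λ j k≤j j<m → above (suc j) (s≤s k≤j) (s≤s j<m)))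

  -- Write `p = (x - β 0) q`. At `β 0` the derivative is `q (β 0)`, a value of `q` below all its
  -- roots. At a later root `q` vanishes, so the derivative is `q′` times a positive factor and the
  -- induction applies.
  sign-deriv : ∀ m p β k → HasPosLead m p → IncreasingRoots m p β → k ℕ.< m →
    0# < sgn (m ∸ suc k) * eval (deriv p) (β k)
  sign-deriv (suc m) p β zero lead roots _ =
    <-respʳ-≈ (*-congˡ (sym (trans (eval-deriv-quot (β 0) p (β 0)) (cancel _ (β 0) _))))
      (sign-between m (quot (β 0) p) (β ∘ suc) (β 0) 0 (quot-lead p (β 0) lead) (quot-roots p β roots) z≤n
        (λ _ ()) (λ j _ j<m → proj₂ roots (s≤s z≤n) (s≤s j<m)))
    where
    cancel : ∀ y x z → y + (x - x) * z ≈ y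
    cancel = solve 3 (λ y x z → y :+ (x :- x) :* z := y) refl
  sign-deriv (suc m) p β (suc k) lead roots (s≤s k<m) =
    sgn-above (sgn (m ∸ suc k)) (β (suc k)) (β 0)
      (trans (eval-deriv-quot (β 0) p (β (suc k)))
        (trans (+-congʳ (proj₁ quot-β k<m)) (+-identityˡ _)))
      (proj₂ roots (s≤s z≤n) (s≤s k<m))
      (sign-deriv m (quot (β 0) p) (β ∘ suc) k (quot-lead p (β 0) lead) quot-β k<m)
    where
    quot-β = quot-roots p β roots

  -- Dividing out `m` of the roots leaves a positive constant that still has a root.
  too-many-roots : ∀ m p β → HasPosLead m p → ¬ IncreasingRoots (suc m) p β
  too-many-roots zero p β (deg , lead) (root , _) =
    <-irrefl (sym (trans (sym (eval-degree0 p (β 0) deg)) (root (s≤s z≤n)))) lead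
  too-many-roots (suc m) p β lead roots =
    too-many-roots m (quot (β 0) p) (β ∘ suc) (quot-lead p (β 0) lead) (quot-roots p β roots)

  -- If α k < γ k, then α 0, …, α k, γ k, …, γ (m - 1) are m + 1 distinct roots.
  roots-≤ : ∀ m p α γ → HasPosLead m p → IncreasingRoots m p α → IncreasingRoots m p γ →
    ∀ {k} → k ℕ.< m → γ k ≤ α k
  roots-≤ m p α γ lead (α-root , α↗) (γ-root , γ↗) {k} k<m αₖ<γₖ =
    too-many-roots m p joined lead (joined-root , joined↗)
    where
    joined : ℕ → Carrier
    joined j with j ℕ.≤? k
    ... | yes _ = α j
    -- The entry `γ k` takes position `k + 1`, hence the shift by one.
    ... | no  _ = γ (ℕ.pred j)
    pred< : ∀ {j} → ¬ j ℕ.≤ k → j ℕ.< suc m → ℕ.pred j ℕ.< m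
    pred< {zero}  j≰k _         = contradiction z≤n j≰k
    pred< {suc j} _   (s≤s j<m) = j<m
    k≤pred : ∀ {j} → ¬ j ℕ.≤ k → k ℕ.≤ ℕ.pred j
    k≤pred j≰k = ℕ.<⇒≤pred (ℕ.≰⇒> j≰k)
    joined-root : ∀ {j} → j ℕ.< suc m → eval p (joined j) ≈ 0#
    joined-root {j} j<1+m with j ℕ.≤? k
    ... | yes j≤k = α-root (ℕ.≤-<-trans j≤k k<m)
    ... | no  j≰k = γ-root (pred< j≰k j<1+m)
    joined↗ : Increasing (suc m) joined
    joined↗ {i} {j} i<j j<1+m with i ℕ.≤? k | j ℕ.≤? k
    ... | yes i≤k | yes j≤k = α↗ i<j (ℕ.≤-<-trans j≤k k<m)
    ... | yes i≤k | no  j≰k = ≤-<-trans (increasing-≤ α α↗ i≤k k<m)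
          (<-≤-trans αₖ<γₖ (increasing-≤ γ γ↗ (k≤pred j≰k) (pred< j≰k j<1+m)))
    ... | no  i≰k | yes j≤k = contradiction (ℕ.≤-trans (ℕ.<⇒≤ i<j) j≤k) i≰k
    ... | no  i≰k | no  j≰k = γ↗ (pred-mono i≰k i<j) (pred< j≰k j<1+m)
      where
      pred-mono : ∀ {i j} → ¬ i ℕ.≤ k → i ℕ.< j → ℕ.pred i ℕ.< ℕ.pred j
      pred-mono {zero}          i≰k _         = contradiction z≤n i≰k
      pred-mono {suc i} {suc j} _   (s≤s i<j) = i<j

  roots-unique : ∀ m p α γ → HasPosLead m p → IncreasingRoots m p α → IncreasingRoots m p γ →
    ∀ {k} → k ℕ.< m → α k ≈ γ k
  roots-unique m p α γ lead α-roots γ-roots k<m = ≤-antisym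
    (roots-≤ m p γ α lead γ-roots α-roots k<m) (roots-≤ m p α γ lead α-roots γ-roots k<m)

-- Points where a polynomial is apart from 0, continuity, and one bisection step.

module IntermediateValue {c ℓ₁ ℓ₂} (ℝ : Reals c ℓ₁ ℓ₂) where
  open Reals ℝ
  open RealPolynomials ℝ hiding (b)
  open Order ℝ
  open PolynomialProperties ℝ

  -- The quotient `q` of `p` by `x - m` has the same leading coefficient and one degree less, so by
  -- induction some `x` above `m` has `q(x)` apart from 0. Then `p(x) - p(m) = (x - m) q(x)` is
  -- apart from 0, and by cotransitivity so is `p(x)` or `p(m)`.
  #0-dense : ∀ d p {u v} → Degree≤ d p → coeff p d # 0# → u < v →
    ∃[ m ] (u < m × m < v × eval p m # 0#)
  #0-dense zero p {u} {v} deg lead u<v = m , u<m , m<v , #-congʳ (sym (eval-degree0 p m deg)) lead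
    where
    mid = midpoint u<v
    m = proj₁ mid
    u<m = proj₁ (proj₂ (proj₂ mid))
    m<v = proj₂ (proj₂ (proj₂ mid))
  #0-dense (suc d) p {u} {v} deg lead u<v = step (#0-dense d (quot m p) (quot-degree m p d deg)
    (#-congʳ (sym (quot-coeff m p d deg)) lead) m<v)
    where
    m = proj₁ (midpoint u<v)
    u<m = proj₁ (proj₂ (proj₂ (midpoint u<v)))
    m<v = proj₂ (proj₂ (proj₂ (midpoint u<v)))
    p[x]#p[m] : ∀ {x} → m < x → eval (quot m p) x # 0# → eval p x # eval p m
    p[x]#p[m] {x} m<x q[x]#0 = x-y#0⇒x#y (#-congʳ
      (trans (y≈x+y-x (eval p m) _) (+-congʳ (sym (quot-eval m p x))))
      (x#0y#0→xy#0 (>⇒# (x<y⇒0<y-x m<x)) q[x]#0))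
    step : ∃[ x ] (m < x × x < v × eval (quot m p) x # 0#) → ∃[ x ] (u < x × x < v × eval p x # 0#)
    step (x , m<x , x<v , q[x]#0) =
      [ (λ p[x]#0 → x , <-trans u<m m<x , x<v , p[x]#0)
      , (λ 0#p[m] → m , u<m , m<v , #-sym 0#p[m]) ]′ (#-cotrans (p[x]#p[m] m<x q[x]#0) 0#)

  infix 4 ∣_∣<_
  ∣_∣<_ : Carrier → Carrier → Set ℓ₂
  ∣ x ∣< b = x < b × - x < b

  abs-bound : ∀ x → ∃[ b ] (0# < b × ∣ x ∣< b)
  abs-bound x = b , 0<b , x<b , -x<b
    where
    b = abs x + 1#
    abs<b : abs x < b
    abs<b = x<x+1 (abs x)
    x<b = ≤-<-trans (x≤max x (- x)) abs<b
    -x<b = ≤-<-trans (y≤max x (- x)) abs<b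
    sum : ∀ b x → b - x + (b - - x) ≈ b + b
    sum = solve 2 (λ b x → b :- x :+ (b :- :- x) := b :+ b) refl
    0<b : 0# < b
    0<b = double-pos (<-respʳ-≈ (sum b x) (+-pos (x<y⇒0<y-x x<b) (x<y⇒0<y-x -x<b)))

  ∣+∣< : ∀ {x y a b} → ∣ x ∣< a → ∣ y ∣< b → ∣ x + y ∣< a + b
  ∣+∣< {x} {y} {a} {b} (x<a , -x<a) (y<b , -y<b) =
    <-from (+-pos (x<y⇒0<y-x x<a) (x<y⇒0<y-x y<b)) (upper x y a b) ,
    <-from (+-pos (x<y⇒0<y-x -x<a) (x<y⇒0<y-x -y<b)) (lower x y a b)
    where
    upper : ∀ x y a b → a - x + (b - y) ≈ a + b - (x + y)
    upper = solve 4 (λ x y a b → a :- x :+ (b :- y) := a :+ b :- (x :+ y)) refl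
    lower : ∀ x y a b → a - - x + (b - - y) ≈ a + b - - (x + y)
    lower = solve 4 (λ x y a b → a :- :- x :+ (b :- :- y) := a :+ b :- :- (x :+ y)) refl

  -- No case distinction on signs is available; instead `(a - x)(b + y) + (a + x)(b - y)` is a sum
  -- of positive terms equal to `2 (a b - x y)`, and similarly for the lower bound.
  ∣*∣< : ∀ {x y a b} → ∣ x ∣< a → ∣ y ∣< b → ∣ x * y ∣< a * b
  ∣*∣< {x} {y} {a} {b} (x<a , -x<a) (y<b , -y<b) =
    0<y-x⇒x<y (double-pos (<-respʳ-≈ (upper x y a b)
      (+-pos (*-pos (x<y⇒0<y-x x<a) (x<y⇒0<y-x -y<b)) (*-pos (x<y⇒0<y-x -x<a) (x<y⇒0<y-x y<b))))) ,
    0<y-x⇒x<y (double-pos (<-respʳ-≈ (lower x y a b)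
      (+-pos (*-pos (x<y⇒0<y-x x<a) (x<y⇒0<y-x y<b)) (*-pos (x<y⇒0<y-x -x<a) (x<y⇒0<y-x -y<b)))))
    where
    upper : ∀ x y a b → (a - x) * (b - - y) + (a - - x) * (b - y) ≈ a * b - x * y + (a * b - x * y)
    upper = solve 4 (λ x y a b → (a :- x) :* (b :- :- y) :+ (a :- :- x) :* (b :- y) :=
                                 a :* b :- x :* y :+ (a :* b :- x :* y)) refl
    lower : ∀ x y a b → (a - x) * (b - y) + (a - - x) * (b - - y) ≈ a * b - - (x * y) + (a * b - - (x * y))
    lower = solve 4 (λ x y a b → (a :- x) :* (b :- y) :+ (a :- :- x) :* (b :- :- y) :=
                                 a :* b :- :- (x :* y) :+ (a :* b :- :- (x :* y))) refl

  ∣∣<-mono : ∀ {x a b} → a < b → ∣ x ∣< a → ∣ x ∣< b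
  ∣∣<-mono a<b (x<a , -x<a) = <-trans x<a a<b , <-trans -x<a a<b

  eval-bounded : ∀ p b → 0# < b → ∃[ M ] (0# < M × (∀ x → ∣ x ∣< b → ∣ eval p x ∣< M))
  eval-bounded []      b 0<b = 1# , 0<1 , λ _ _ → 0<1 , <-respˡ-≈ (sym -0≈0) 0<1
    where
    -0≈0 : - 0# ≈ 0#
    -0≈0 = solve 0 (:- con (ℤ.+ 0) := con (ℤ.+ 0)) refl
  eval-bounded (a ∷ p) b 0<b = step (abs-bound a) (eval-bounded p b 0<b)
    where
    Bounded : Poly → Set _
    Bounded p = ∃[ M ] (0# < M × (∀ x → ∣ x ∣< b → ∣ eval p x ∣< M))
    step : ∃[ A ] (0# < A × ∣ a ∣< A) → Bounded p → Bounded (a ∷ p)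
    step (A , 0<A , ∣a∣<A) (M , 0<M , ∣p∣<M) =
      A + b * M , +-pos 0<A (*-pos 0<b 0<M) , λ x ∣x∣<b → ∣+∣< ∣a∣<A (∣*∣< ∣x∣<b (∣p∣<M x ∣x∣<b))

  -- A local Lipschitz bound: `p(y) - p(x)` is `y - x` times the quotient by the linear factor at
  -- `x`, and that quotient is bounded near `x`.
  eval-continuous : ∀ p x {e} → 0# < e →
    ∃[ δ ] (0# < δ × (∀ y → ∣ y - x ∣< δ → ∣ eval p y - eval p x ∣< e))
  eval-continuous p x {e} 0<e = δ , 0<δ , close
    where
    X = proj₁ (abs-bound x)
    0<X = proj₁ (proj₂ (abs-bound x))
    ∣x∣<X = proj₂ (proj₂ (abs-bound x))
    bound = eval-bounded (quot x p) (X + 1#) (+-pos 0<X 0<1)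
    M = proj₁ bound
    0<M = proj₁ (proj₂ bound)
    r = proj₁ (inverse-pos 0<M)
    0<r = proj₁ (proj₂ (inverse-pos 0<M))
    rM≈1 = proj₂ (proj₂ (inverse-pos 0<M))
    -- Being below 1 keeps `y` in the region where `M` bounds the quotient; being below `e / M`
    -- makes `δ * M` smaller than `e`.
    small = positive-below 0<1 (*-pos 0<e 0<r)
    δ = proj₁ small
    0<δ = proj₁ (proj₂ small)
    δ<1 = proj₁ (proj₂ (proj₂ small))
    δ<er = proj₂ (proj₂ (proj₂ small))
    distribute : ∀ e r M δ → M * (e * r - δ) ≈ e * (r * M) - δ * M
    distribute = solve 4 (λ e r M δ → M :* (e :* r :- δ) := e :* (r :* M) :- δ :* M) refl
    δM<e : δ * M < e
    δM<e = <-from (*-pos 0<M (x<y⇒0<y-x δ<er)) (trans (distribute e r M δ)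
      (+-congʳ (trans (*-congˡ rM≈1) (*-identityʳ e))))
    restore : ∀ x y → x + (y - x) ≈ y
    restore = solve 2 (λ x y → x :+ (y :- x) := y) refl
    ∣∣<-resp : ∀ {x y b} → x ≈ y → ∣ x ∣< b → ∣ y ∣< b
    ∣∣<-resp x≈y (x<b , -x<b) = <-respˡ-≈ x≈y x<b , <-respˡ-≈ (-‿cong x≈y) -x<b
    close : ∀ y → ∣ y - x ∣< δ → ∣ eval p y - eval p x ∣< e
    close y ∣y-x∣<δ = ∣∣<-resp
      (trans (y≈x+y-x (eval p x) _) (+-congʳ (sym (quot-eval x p y))))
      (∣∣<-mono δM<e (∣*∣< ∣y-x∣<δ (proj₂ (proj₂ bound) y
        (∣∣<-resp (restore x y) (∣+∣< ∣x∣<X (∣∣<-mono δ<1 ∣y-x∣<δ))))))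

  -- The difference `y - x` is a factor of `p(y)`. This turns weak inequalities between a root and a
  -- non-root into strict ones.
  root-# : ∀ p {x y} → eval p x ≈ 0# → eval p y # 0# → y # x
  root-# p {x} {y} p[x]≈0 p[y]#0 = x-y#0⇒x#y (*#0⇒#0ʳ
    (#-congʳ (trans (quot-root p y p[x]≈0) (*-comm _ _)) p[y]#0))

  module Bisection (p : Poly) (d : ℕ) (deg : Degree≤ d p) (lead : coeff p d # 0#) where

    record Bracket : Set (c ⊔ ℓ₂) where
      field
        left right : Carrier
        left<right : left < right
        left-neg   : eval p left < 0#
        right-pos  : 0# < eval p right

      width : Carrier
      width = right - left

      0<width : 0# < width
      0<width = x<y⇒0<y-x left<right

    open Bracket

    -- Signs of p can only be decided away from its zeros, so the interval is cut
    -- at some point of its middle half.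
    shrink : (B : Bracket) → ∃[ B′ ] (left B ≤ left B′ × right B′ ≤ right B ×
      (1# + 1# + 1# + 1#) * width B′ < (1# + 1# + 1#) * width B)
    shrink B = [ keep-right , keep-left ]′ (#⇒<⊎> p[m]#0)
      where
      a = left B
      b = right B
      mid = midpoint (left<right B)
      x = proj₁ mid
      2x≈a+b = proj₁ (proj₂ mid)
      a<x = proj₁ (proj₂ (proj₂ mid))
      x<b = proj₂ (proj₂ (proj₂ mid))
      midₗ = midpoint a<x
      u = proj₁ midₗ
      2u≈a+x = proj₁ (proj₂ midₗ)
      a<u = proj₁ (proj₂ (proj₂ midₗ))
      u<x = proj₂ (proj₂ (proj₂ midₗ))
      midᵣ = midpoint x<b
      v = proj₁ midᵣ
      2v≈x+b = proj₁ (proj₂ midᵣ)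
      x<v = proj₁ (proj₂ (proj₂ midᵣ))
      v<b = proj₂ (proj₂ (proj₂ midᵣ))
      dense = #0-dense d p deg lead (<-trans u<x x<v)
      m = proj₁ dense
      u<m = proj₁ (proj₂ dense)
      m<v = proj₁ (proj₂ (proj₂ dense))
      p[m]#0 = proj₂ (proj₂ (proj₂ dense))
      a<m = <-trans a<u u<m
      m<b = <-trans m<v v<b
      double² : ∀ {z s t} → z + z ≈ s + t → z + z + (z + z) ≈ s + s + (t + t)
      double² {z} {s} {t} 2z≈ = trans (+-cong 2z≈ 2z≈) (interchange s t)
        where
        interchange : ∀ s t → s + t + (s + t) ≈ s + s + (t + t)
        interchange = solve 2 (λ s t → s :+ t :+ (s :+ t) := s :+ s :+ (t :+ t)) refl
      -- The points `u` and `v` are the quarter points of the bracket, so a cut strictly between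
      -- them leaves less than three quarters of the width on either side.
      4u≈ : u + u + (u + u) ≈ a + a + (a + b)
      4u≈ = trans (double² 2u≈a+x) (+-congˡ 2x≈a+b)
      4v≈ : v + v + (v + v) ≈ a + b + (b + b)
      4v≈ = trans (double² 2v≈x+b) (+-congʳ 2x≈a+b)
      Shrunk = ∃[ B′ ] (a ≤ left B′ × right B′ ≤ b ×
        (1# + 1# + 1# + 1#) * width B′ < (1# + 1# + 1#) * width B)
      0<4 = +-pos (+-pos 0<2 0<1) 0<1
      keep-right : eval p m < 0# → Shrunk
      keep-right p[m]<0 =
        record { left = m ; right = b ; left<right = m<b ; left-neg = p[m]<0 ; right-pos = right-pos B }
        , <⇒≤ a<m , ≈⇒≤ refl
        , <-from (*-pos 0<4 (x<y⇒0<y-x u<m))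
            (trans (expand b m u) (trans (+-congʳ (+-congˡ (-‿cong 4u≈))) (collect a b m)))
        where
        expand : ∀ b m u → (1# + 1# + 1# + 1#) * (m - u) ≈
          (1# + 1# + 1# + 1#) * b - (u + u + (u + u)) - (1# + 1# + 1# + 1#) * (b - m)
        expand = solve 3 (λ b m u → con (ℤ.+ 4) :* (m :- u) :=
          con (ℤ.+ 4) :* b :- (u :+ u :+ (u :+ u)) :- con (ℤ.+ 4) :* (b :- m)) refl
        collect : ∀ a b m → (1# + 1# + 1# + 1#) * b - (a + a + (a + b)) - (1# + 1# + 1# + 1#) * (b - m) ≈
          (1# + 1# + 1#) * (b - a) - (1# + 1# + 1# + 1#) * (b - m)
        collect = solve 3 (λ a b m → con (ℤ.+ 4) :* b :- (a :+ a :+ (a :+ b)) :- con (ℤ.+ 4) :* (b :- m) :=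
          con (ℤ.+ 3) :* (b :- a) :- con (ℤ.+ 4) :* (b :- m)) refl
      keep-left : 0# < eval p m → Shrunk
      keep-left 0<p[m] =
        record { left = a ; right = m ; left<right = a<m ; left-neg = left-neg B ; right-pos = 0<p[m] }
        , ≈⇒≤ refl , <⇒≤ m<b
        , <-from (*-pos 0<4 (x<y⇒0<y-x m<v))
            (trans (expand a m v) (trans (+-congʳ (+-congʳ 4v≈)) (collect a b m)))
        where
        expand : ∀ a m v → (1# + 1# + 1# + 1#) * (v - m) ≈
          v + v + (v + v) - (1# + 1# + 1# + 1#) * a - (1# + 1# + 1# + 1#) * (m - a)
        expand = solve 3 (λ a m v → con (ℤ.+ 4) :* (v :- m) :=
          v :+ v :+ (v :+ v) :- con (ℤ.+ 4) :* a :- con (ℤ.+ 4) :* (m :- a)) refl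
        collect : ∀ a b m → a + b + (b + b) - (1# + 1# + 1# + 1#) * a - (1# + 1# + 1# + 1#) * (m - a) ≈
          (1# + 1# + 1#) * (b - a) - (1# + 1# + 1# + 1#) * (m - a)
        collect = solve 3 (λ a b m → a :+ b :+ (b :+ b) :- con (ℤ.+ 4) :* a :- con (ℤ.+ 4) :* (m :- a) :=
          con (ℤ.+ 3) :* (b :- a) :- con (ℤ.+ 4) :* (m :- a)) refl

-- Convergence of the bisection and the intermediate value theorem.

module BisectionLimit {c ℓ₁ ℓ₂} (ℝ : Reals c ℓ₁ ℓ₂) where
  open Reals ℝ
  open RealPolynomials ℝ hiding (b)
  open Order ℝ
  open PolynomialProperties ℝ
  open IntermediateValue ℝ

  sub-mono-≤ : ∀ {x y z w} → x ≤ y → z ≤ w → x - w ≤ y - z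
  sub-mono-≤ {x} {y} {z} {w} x≤y z≤w = ≤-trans x-w≤x-z x-z≤y-z
    where
    differenceˡ : ∀ x z w → x - w - (x - z) ≈ z - w
    differenceˡ = solve 3 (λ x z w → x :- w :- (x :- z) := z :- w) refl
    differenceʳ : ∀ x y z → x - z - (y - z) ≈ x - y
    differenceʳ = solve 3 (λ x y z → x :- z :- (y :- z) := x :- y) refl
    x-w≤x-z : x - w ≤ x - z
    x-w≤x-z x-z<x-w = z≤w (<-from (x<y⇒0<y-x x-z<x-w) (differenceˡ x z w))
    x-z≤y-z : x - z ≤ y - z
    x-z≤y-z y-z<x-z = x≤y (<-from (x<y⇒0<y-x y-z<x-z) (differenceʳ x y z))

  module _ (p : Poly) (d : ℕ) (deg : Degree≤ d p) (lead : coeff p d # 0#) where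
    open Bisection p d deg lead
    open Bracket

    module _ (start : Bracket) where

      bracket : ℕ → Bracket
      bracket zero    = start
      bracket (suc n) = proj₁ (shrink (bracket n))

      bracket-mono : ∀ {i j} → i ℕ.≤ j →
        left (bracket i) ≤ left (bracket j) × right (bracket j) ≤ right (bracket i)
      bracket-mono {i} {j} i≤j = go (ℕ.≤⇒≤′ i≤j)
        where
        go : ∀ {j} → i ℕ.≤′ j →
          left (bracket i) ≤ left (bracket j) × right (bracket j) ≤ right (bracket i)
        go ℕ.≤′-refl = ≈⇒≤ refl , ≈⇒≤ refl
        go (ℕ.≤′-step {j} i≤′j) =
          ≤-trans (proj₁ (go i≤′j)) (proj₁ (proj₂ (shrink (bracket j)))) ,
          ≤-trans (proj₁ (proj₂ (proj₂ (shrink (bracket j))))) (proj₂ (go i≤′j))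

      -- An additive substitute for geometric decay: since 4 w′ < 3 w, passing from
      -- n to n + 1 decreases (n + 4) w.
      width-decay : ∀ n → (fromℕ (suc n) + (1# + 1# + 1#)) * width (bracket n) ≤
        (1# + 1# + 1# + 1#) * width start
      width-decay zero = ≈⇒≤ (identity (width start))
        where
        identity : ∀ w → (1# + 0# + (1# + 1# + 1#)) * w ≈ (1# + 1# + 1# + 1#) * w
        identity = solve 1 (λ w → (con (ℤ.+ 1) :+ con (ℤ.+ 0) :+ con (ℤ.+ 3)) :* w := con (ℤ.+ 4) :* w) refl
      width-decay (suc n) = ≤-trans (<⇒≤ decrease) (width-decay n)
        where
        f = fromℕ (suc n)
        w = width (bracket n)
        w′ = width (bracket (suc n))
        0<3 : 0# < 1# + 1# + 1#
        0<3 = +-pos 0<2 0<1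
        0<f : 0# < f
        0<f = fromℕ-pos (suc n)
        gain : 0# < (1# + 1# + 1#) * w - (1# + 1# + 1# + 1#) * w′
        gain = x<y⇒0<y-x (proj₂ (proj₂ (proj₂ (shrink (bracket n)))))
        -- With the shift 3 added to `f`, the surplus `4 (f + 3) - 3 (f + 4)` in the coefficient of
        -- `w′` is exactly `f`, which is positive.
        identity : ∀ f w w′ →
          (f + (1# + 1# + 1#)) * ((1# + 1# + 1#) * w - (1# + 1# + 1# + 1#) * w′) + f * w′ ≈
          (1# + 1# + 1#) * ((f + (1# + 1# + 1#)) * w - (1# + f + (1# + 1# + 1#)) * w′)
        identity = solve 3 (λ f w w′ →
          (f :+ con (ℤ.+ 3)) :* (con (ℤ.+ 3) :* w :- con (ℤ.+ 4) :* w′) :+ f :* w′ :=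
          con (ℤ.+ 3) :* ((f :+ con (ℤ.+ 3)) :* w :- (con (ℤ.+ 1) :+ f :+ con (ℤ.+ 3)) :* w′)) refl
        decrease : (1# + f + (1# + 1# + 1#)) * w′ < (f + (1# + 1# + 1#)) * w
        decrease = 0<y-x⇒x<y (*-cancelˡ-pos 0<3 (<-respʳ-≈ (identity f w w′)
          (+-pos (*-pos (+-pos 0<f 0<3) gain) (*-pos 0<f (0<width (bracket (suc n)))))))

      -- For `W` four times the initial width, `(K + 4) w ≤ W` by `width-decay`, and a natural
      -- number `K` above `W / e` makes `W` less than `(K + 4) e`.
      width-small : ∀ {e} → 0# < e → ∃[ n ] width (bracket n) < e
      width-small {e} 0<e = K , 0<y-x⇒x<y (*-cancelˡ-pos (+-pos 0<f 0<3) (<-respʳ-≈ (distribute _ e w) (x<y⇒0<y-x bound)))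
        where
        W = (1# + 1# + 1# + 1#) * width start
        r = proj₁ (inverse-pos 0<e)
        re≈1 = proj₂ (proj₂ (inverse-pos 0<e))
        K = proj₁ (archimedean (W * r))
        f = fromℕ (suc K)
        0<f : 0# < f
        0<f = fromℕ-pos (suc K)
        0<3 : 0# < 1# + 1# + 1#
        0<3 = +-pos 0<2 0<1
        w = width (bracket K)
        distribute : ∀ g e w → g * e - g * w ≈ g * (e - w)
        distribute = solve 3 (λ g e w → g :* e :- g :* w := g :* (e :- w)) refl
        gap : 0# < fromℕ K - W * r
        gap = x<y⇒0<y-x (proj₂ (archimedean (W * r)))
        identity : ∀ k W r e → e * (k - W * r) + (1# + 1# + 1# + 1#) * e ≈
          (1# + k + (1# + 1# + 1#)) * e - W * (r * e)
        identity = solve 4 (λ k W r e → e :* (k :- W :* r) :+ con (ℤ.+ 4) :* e :=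
          (con (ℤ.+ 1) :+ k :+ con (ℤ.+ 3)) :* e :- W :* (r :* e)) refl
        W<fe : W < (f + (1# + 1# + 1#)) * e
        W<fe = <-from (+-pos (*-pos 0<e gap) (*-pos (+-pos 0<3 0<1) 0<e)) (trans (identity (fromℕ K) W r e)
          (+-congˡ (-‿cong (trans (*-congˡ re≈1) (*-identityʳ W)))))
        bound : (f + (1# + 1# + 1#)) * w < (f + (1# + 1# + 1#)) * e
        bound = ≤-<-trans (width-decay K) W<fe

      left<right′ : ∀ i N → left (bracket i) < right (bracket N)
      left<right′ i N = [ (λ i≤N → ≤-<-trans (proj₁ (bracket-mono i≤N)) (left<right (bracket N)))
                        , (λ N≤i → <-≤-trans (left<right (bracket i)) (proj₂ (bracket-mono N≤i))) ]′ (ℕ.≤-total i N)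

      left-cauchy : IsCauchy (left ∘ bracket)
      left-cauchy e 0<e = N , λ j k N≤j N≤k →
        abs-< (close j k N≤k) (<-respˡ-≈ (x-y≈-[y-x] (left (bracket k)) (left (bracket j))) (close k j N≤j))
        where
        N = proj₁ (width-small 0<e)
        w<e = proj₂ (width-small 0<e)
        close : ∀ j k → N ℕ.≤ k → left (bracket j) - left (bracket k) < e
        close j k N≤k = ≤-<-trans (sub-mono-≤ (<⇒≤ (left<right′ j N)) (proj₁ (bracket-mono N≤k))) w<e

      limit : Carrier
      limit = proj₁ (complete (left ∘ bracket) left-cauchy)

      limit-converges : (left ∘ bracket) ConvergesTo limit
      limit-converges = proj₂ (complete (left ∘ bracket) left-cauchy)

      left≤limit : ∀ n → left (bracket n) ≤ limit
      left≤limit n limit<left = proj₁ (bracket-mono n≤j) (0<y-x⇒x<y (<-respʳ-≈ (cancel _ _ _)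
          (x<y⇒0<y-x (abs<⇒< (near j (ℕ.m≤m⊔n N n))))))
        where
        near-N = limit-converges (left (bracket n) - limit) (x<y⇒0<y-x limit<left)
        N = proj₁ near-N
        near = proj₂ near-N
        j = N ℕ.⊔ n
        n≤j = ℕ.m≤n⊔m N n
        cancel : ∀ x y l → y - l - (x - l) ≈ y - x
        cancel = solve 3 (λ x y l → y :- l :- (x :- l) := y :- x) refl

      limit≤right : ∀ n → limit ≤ right (bracket n)
      limit≤right n right<limit = <-asym (left<right′ N n) (0<y-x⇒x<y (<-respʳ-≈ (cancel _ _ _)
          (x<y⇒0<y-x (abs<⇒-< (near N ℕ.≤-refl)))))
        where
        near-N = limit-converges (limit - right (bracket n)) (x<y⇒0<y-x right<limit)
        N = proj₁ near-N
        near = proj₂ near-N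
        cancel : ∀ x r l → l - r - - (x - l) ≈ x - r
        cancel = solve 3 (λ x r l → l :- r :- :- (x :- l) := x :- r) refl

      limit-near : ∀ {δ} → 0# < δ →
        ∃[ n ] (∣ left (bracket n) - limit ∣< δ × ∣ right (bracket n) - limit ∣< δ)
      limit-near {δ} 0<δ = n
        , ( ≤-<-trans (sub-mono-≤ l≤r (left≤limit n)) w<δ
          , <-respˡ-≈ (x-y≈-[y-x] limit l) (≤-<-trans (sub-mono-≤ (limit≤right n) (≈⇒≤ refl)) w<δ))
        , ( ≤-<-trans (sub-mono-≤ (≈⇒≤ refl) (left≤limit n)) w<δ
          , <-respˡ-≈ (x-y≈-[y-x] limit r) (≤-<-trans (sub-mono-≤ (limit≤right n) l≤r) w<δ))
        where
        n = proj₁ (width-small 0<δ)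
        w<δ = proj₂ (width-small 0<δ)
        l = left (bracket n)
        r = right (bracket n)
        l≤r : l ≤ r
        l≤r = <⇒≤ (left<right (bracket n))

      -- By continuity p(limit) ≠ 0 would force p to have the same sign at both
      -- ends of a small bracket.
      limit-root : eval p limit ≈ 0#
      limit-root = ≤-antisym not-pos not-neg
        where
        not-pos : eval p limit ≤ 0#
        not-pos 0<p = <-asym (left-neg (bracket (proj₁ near)))
            (<-from (x<y⇒0<y-x (proj₂ (close _ (proj₁ (proj₂ near))))) (identity _ _))
          where
          continuity = eval-continuous p limit 0<p
          close = proj₂ (proj₂ continuity)
          near = limit-near (proj₁ (proj₂ continuity))
          identity : ∀ y l → l - - (y - l) ≈ y - 0#
          identity = solve 2 (λ y l → l :- :- (y :- l) := y :- con (ℤ.+ 0)) refl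
        not-neg : 0# ≤ eval p limit
        not-neg p<0 = <-asym (right-pos (bracket (proj₁ near)))
            (<-from (x<y⇒0<y-x (proj₁ (close _ (proj₂ (proj₂ near))))) (identity _ _))
          where
          continuity = eval-continuous p limit (neg-pos p<0)
          close = proj₂ (proj₂ continuity)
          near = limit-near (proj₁ (proj₂ continuity))
          identity : ∀ y l → - l - (y - l) ≈ 0# - y
          identity = solve 2 (λ y l → :- l :- (y :- l) := con (ℤ.+ 0) :- y) refl

    intermediate-value : ∀ {a b} → a < b → eval p a < 0# → 0# < eval p b →
      ∃[ x ] (a < x × x < b × eval p x ≈ 0#)
    intermediate-value {a} {b} a<b p[a]<0 0<p[b] = x
      -- The limit gives only `a ≤ x`; strictness holds because `p` vanishes at `x` but is apart
      -- from 0 at `a`.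
      , #∧≤⇒< (root-# p p[x]≈0 (<⇒# p[a]<0)) (left≤limit start 0)
      , #∧≤⇒< (#-sym (root-# p p[x]≈0 (>⇒# 0<p[b]))) (limit≤right start 0)
      , p[x]≈0
      where
      start : Bracket
      start = record { left = a ; right = b ; left<right = a<b ; left-neg = p[a]<0 ; right-pos = 0<p[b] }
      x = limit start
      p[x]≈0 = limit-root start

-- Roots from sign changes, behaviour at infinity, Rolle's theorem, and sorting of roots.

module RootConstruction {c ℓ₁ ℓ₂} (ℝ : Reals c ℓ₁ ℓ₂) where
  open Reals ℝ
  open RealPolynomials ℝ hiding (b)
  open Order ℝ
  open PolynomialProperties ℝ
  open Signs ℝ
  open BisectionLimit ℝ

  -- Scaling by `sgn j` turns the sign change into one from negative to positive. That the scalar is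
  -- apart from 0 follows from the positive product at `b`.
  intermediate-root : ∀ d p j {a b} → HasPosLead d p → a < b →
    0# < sgn (suc j) * eval p a → 0# < sgn j * eval p b →
    ∃[ x ] (a < x × x < b × eval p x ≈ 0#)
  intermediate-root d p j {a} {b} (deg , lead) a<b 0<-sp[a] 0<sp[b] =
    proj₁ root , proj₁ (proj₂ root) , proj₁ (proj₂ (proj₂ root))
    , *≈0⇒≈0 s#0 (trans (sym (eval-scale s p _)) (proj₂ (proj₂ (proj₂ root))))
    where
    s = sgn j
    s#0 : s # 0#
    s#0 = *#0⇒#0ʳ (#-congʳ (*-comm s (eval p b)) (>⇒# 0<sp[b]))
    neg-* : ∀ s y → - s * y ≈ - (s * y)
    neg-* = solve 2 (λ s y → :- s :* y := :- (s :* y)) refl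
    root = intermediate-value (scale s p) d
      (λ i d<i → trans (coeff-scale s p i) (trans (*-congˡ (deg i d<i)) (zeroʳ s)))
      (#-congʳ (sym (coeff-scale s p d)) (x#0y#0→xy#0 s#0 (>⇒# lead)))
      a<b
      (<-respˡ-≈ (sym (eval-scale s p a)) (pos-neg (<-respʳ-≈ (neg-* s (eval p a)) 0<-sp[a])))
      (<-respʳ-≈ (sym (eval-scale s p b)) 0<sp[b])

  -- u = 1 and u = - 1 describe p near + ∞ and - ∞; s d is u to the power d.
  eventually-pos : ∀ u (s : ℕ → Carrier) → u * u ≈ 1# → s 0 ≈ 1# → (∀ d → s (suc d) ≈ u * s d) →
    ∀ d p → HasPosLead d p →
    ∃[ y ] ∃[ e ] (0# < e × (∀ t → y < t → e < s d * eval p (u * t)))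
  eventually-pos u s u²≈1 s₀≈1 s-suc zero p (deg , lead) =
    0# , proj₁ below , proj₁ (proj₂ below) , λ t _ → <-respʳ-≈
      (sym (trans (*-cong s₀≈1 (eval-degree0 p (u * t) deg)) (*-identityˡ _)))
      (proj₁ (proj₂ (proj₂ below)))
    where
    below = positive-below lead lead
  eventually-pos u s u²≈1 s₀≈1 s-suc (suc d) []      (_ , 0<0) = ⊥-elim (<-irrefl refl 0<0)
  eventually-pos u s u²≈1 s₀≈1 s-suc (suc d) (a ∷ p) (deg , lead) =
    step (eventually-pos u s u²≈1 s₀≈1 s-suc d p (tail-degree {c = a} {p} deg , lead))
    where
    step : ∃[ y ] ∃[ e ] (0# < e × (∀ t → y < t → e < s d * eval p (u * t))) →
      ∃[ y ] ∃[ e ] (0# < e × (∀ t → y < t → e < s (suc d) * (a + u * t * eval p (u * t))))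
    step (y , e , 0<e , large) = y′ , 1# , 0<1 , λ t y′<t →
      <-from (+-pos (*-pos 0<e (x<y⇒0<y-x (≤-<-trans z≤y′ y′<t)))
                    (*-pos (≤-<-trans 0≤y′ y′<t) (x<y⇒0<y-x (large t (≤-<-trans y≤y′ y′<t)))))
        (difference t)
      where
      r = proj₁ (inverse-pos 0<e)
      re≈1 = proj₂ (proj₂ (inverse-pos 0<e))
      k = s (suc d) * a
      -- The value in question is `k + t * Y` with `Y > e`, so it exceeds 1 once `t > (1 - k) / e`,
      -- given that `t` is positive. The induction therefore carries a uniform lower bound `e` and
      -- not mere positivity.
      z = (1# - k) * r
      y′ = max y (max 0# z)
      y≤y′ = x≤max y (max 0# z)
      0≤y′ = ≤-trans (x≤max 0# z) (y≤max y (max 0# z))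
      z≤y′ = ≤-trans (y≤max 0# z) (y≤max y (max 0# z))
      expand : ∀ e t k r Y → e * (t - (1# - k) * r) + t * (Y - e) ≈ t * Y - (1# - k) * (r * e)
      expand = solve 5 (λ e t k r Y → e :* (t :- (con (ℤ.+ 1) :- k) :* r) :+ t :* (Y :- e) :=
        t :* Y :- (con (ℤ.+ 1) :- k) :* (r :* e)) refl
      simplify : ∀ t k Y → t * Y - (1# - k) * 1# ≈ k + t * (1# * Y) - 1#
      simplify = solve 3 (λ t k Y → t :* Y :- (con (ℤ.+ 1) :- k) :* con (ℤ.+ 1) :=
        k :+ t :* (con (ℤ.+ 1) :* Y) :- con (ℤ.+ 1)) refl
      collect : ∀ u s a t q → u * s * a + t * (u * u * (s * q)) ≈ u * s * (a + u * t * q)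
      collect = solve 5 (λ u s a t q → u :* s :* a :+ t :* (u :* u :* (s :* q)) :=
        u :* s :* (a :+ u :* t :* q)) refl
      difference : ∀ t → e * (t - z) + t * (s d * eval p (u * t) - e) ≈
        s (suc d) * (a + u * t * eval p (u * t)) - 1#
      difference t = begin
        e * (t - z) + t * (Y - e)                     ≈⟨ expand e t k r Y ⟩
        t * Y - (1# - k) * (r * e)                    ≈⟨ +-congˡ (-‿cong (*-congˡ re≈1)) ⟩
        t * Y - (1# - k) * 1#                         ≈⟨ simplify t k Y ⟩
        k + t * (1# * Y) - 1#                         ≈⟨ +-congʳ (+-cong (*-congʳ (s-suc d)) (*-congˡ (*-congʳ (sym u²≈1)))) ⟩
        u * s d * a + t * (u * u * Y) - 1#            ≈⟨ +-congʳ (collect u (s d) a t q) ⟩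
        u * s d * (a + u * t * q) - 1#                ≈⟨ +-congʳ (*-congʳ (s-suc d)) ⟨
        s (suc d) * (a + u * t * q) - 1#              ∎
        where
        open SetoidReasoning setoid
        q = eval p (u * t)
        Y = s d * q

  pos-right : ∀ d p x → HasPosLead d p → ∃[ t ] (x < t × 0# < sgn 0 * eval p t)
  pos-right d p x lead = t , x<t
    , <-respʳ-≈ (*-congˡ (eval-cong p (*-identityˡ t))) (<-trans 0<e (large t y<t))
    where
    growth = eventually-pos 1# (λ _ → 1#) (*-identityˡ 1#) refl (λ _ → sym (*-identityˡ 1#)) d p lead
    y = proj₁ growth
    0<e = proj₁ (proj₂ (proj₂ growth))
    large = proj₂ (proj₂ (proj₂ growth))
    t = max x y + 1#
    x<t = ≤-<-trans (x≤max x y) (x<x+1 (max x y))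
    y<t = ≤-<-trans (y≤max x y) (x<x+1 (max x y))

  pos-left : ∀ d p x → HasPosLead d p → ∃[ t ] (t < x × 0# < sgn d * eval p t)
  pos-left d p x lead = - 1# * t , <-from (x<y⇒0<y-x -x<t) (flip t x) , <-trans 0<e (large t y<t)
    where
    square : - 1# * - 1# ≈ 1#
    square = solve 0 (:- con (ℤ.+ 1) :* :- con (ℤ.+ 1) := con (ℤ.+ 1)) refl
    -1* : ∀ s → - s ≈ - 1# * s
    -1* = solve 1 (λ s → :- s := :- con (ℤ.+ 1) :* s) refl
    growth = eventually-pos (- 1#) sgn square refl (λ d → -1* (sgn d)) d p lead
    y = proj₁ growth
    0<e = proj₁ (proj₂ (proj₂ growth))
    large = proj₂ (proj₂ (proj₂ growth))
    t = max (- x) y + 1#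
    -x<t = ≤-<-trans (x≤max (- x) y) (x<x+1 (max (- x) y))
    y<t = ≤-<-trans (y≤max (- x) y) (x<x+1 (max (- x) y))
    flip : ∀ t x → t - - x ≈ x - - 1# * t
    flip = solve 2 (λ t x → t :- :- x := x :- :- con (ℤ.+ 1) :* t) refl

  choose : ∀ {ℓ} m {Q : ℕ → Carrier → Set ℓ} → (∀ k → k ℕ.< m → ∃[ x ] Q k x) →
    ∃[ γ ] (∀ k → k ℕ.< m → Q k (γ k))
  choose m {Q} find = γ , γ-spec
    where
    γ : ℕ → Carrier
    γ k with k ℕ.<? m
    ... | yes k<m = proj₁ (find k k<m)
    -- A default value outside the range; it makes `γ` total.
    ... | no  _   = 0#
    γ-spec : ∀ k → k ℕ.< m → Q k (γ k)
    γ-spec k k<m with k ℕ.<? m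
    ... | yes k<m′ = proj₂ (find k k<m′)
    ... | no  k≮m  = contradiction k<m k≮m

  adjacent⇒increasing : ∀ m γ → (∀ k → suc k ℕ.< m → γ k < γ (suc k)) → Increasing m γ
  adjacent⇒increasing m γ adjacent i<j j<m = go (ℕ.≤⇒≤′ i<j) j<m
    where
    go : ∀ {i j} → suc i ℕ.≤′ j → j ℕ.< m → γ i < γ j
    go ℕ.≤′-refl j<m = adjacent _ j<m
    go (ℕ.≤′-step i<′j) 1+j<m = <-trans (go i<′j (ℕ.<-trans (ℕ.n<1+n _) 1+j<m)) (adjacent _ 1+j<m)

  -- The signs at `e k` and `e (suc k)` are opposite, so every gap holds a root, and roots from
  -- successive gaps are automatically in increasing order.
  interlacing-roots : ∀ m d p (e : ℕ → Carrier) → HasPosLead d p →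
    (∀ k → k ℕ.< m → e k < e (suc k)) →
    (∀ k → k ℕ.≤ m → 0# < sgn (m ∸ k) * eval p (e k)) →
    ∃[ β ] (IncreasingRoots m p β × (∀ k → k ℕ.< m → e k < β k × β k < e (suc k)))
  interlacing-roots m d p e lead e↗ sign = β
    , ( (λ {k} k<m → proj₂ (proj₂ (β-spec k k<m)))
      , adjacent⇒increasing m β λ k 1+k<m → <-trans
          (proj₁ (proj₂ (β-spec k (ℕ.<-trans (ℕ.n<1+n k) 1+k<m)))) (proj₁ (β-spec (suc k) 1+k<m)))
    , λ k k<m → proj₁ (β-spec k k<m) , proj₁ (proj₂ (β-spec k k<m))
    where
    find : ∀ k → k ℕ.< m → ∃[ x ] (e k < x × x < e (suc k) × eval p x ≈ 0#)
    find k k<m = intermediate-root d p (m ∸ suc k) lead (e↗ k k<m)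
      (≡.subst (λ j → 0# < sgn j * eval p (e k)) (ℕ.+-∸-assoc 1 k<m) (sign k (ℕ.<⇒≤ k<m)))
      (sign (suc k) k<m)
    chosen = choose m find
    β = proj₁ chosen
    β-spec = proj₂ chosen

  deriv-lead : ∀ d p → HasPosLead (suc d) p → HasPosLead d (deriv p)
  deriv-lead d p (deg , lead) =
    (λ j d<j → trans (coeff-deriv p j) (·-zero (suc j) (deg (suc j) (s≤s d<j))))
    , <-respʳ-≈ (sym (coeff-deriv p d)) (·-pos d lead)

  rolle : ∀ m p β → HasPosLead (suc m) p → IncreasingRoots (suc m) p β →
    ∃[ γ ] (IncreasingRoots m (deriv p) γ × (∀ k → k ℕ.< m → β k < γ k × γ k < β (suc k)))
  rolle m p β lead roots = interlacing-roots m m (deriv p) β (deriv-lead m p lead)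
    (λ k k<m → proj₂ roots (ℕ.n<1+n k) (s≤s k<m))
    (λ k k≤m → sign-deriv (suc m) p β k lead roots (s≤s k≤m))

  -- The sign changes are taken along `lo`, `α 0`, ..., `α (m - 1)`, `hi`, which have `m + 1` gaps.
  -- For `m = 0` the list is just `lo`, `hi`, and `lo < hi` orders it.
  roots-between : ∀ m p α lo hi → HasPosLead (suc m) p → Increasing m α →
    (∀ k → k ℕ.< m → 0# < sgn (m ∸ k) * eval p (α k)) →
    lo < α 0 → lo < hi → α (ℕ.pred m) < hi →
    0# < sgn (suc m) * eval p lo → 0# < sgn 0 * eval p hi → ∃[ β ] IncreasingRoots (suc m) p β
  roots-between m p α lo hi lead α↗ sign lo<α₀ lo<hi α<hi lo-sign hi-sign =
    proj₁ roots , proj₁ (proj₂ roots)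
    where
    e : ℕ → Carrier
    e zero    = lo
    e (suc k) with k ℕ.<? m
    ... | yes _ = α k
    ... | no  _ = hi
    lo<e₁ : lo < e 1
    lo<e₁ with 0 ℕ.<? m
    ... | yes _ = lo<α₀
    ... | no  _ = lo<hi
    e↗ : ∀ k → k ℕ.< suc m → e k < e (suc k)
    e↗ zero    _         = lo<e₁
    e↗ (suc k) (s≤s k<m) with k ℕ.<? m | suc k ℕ.<? m
    ... | yes _ | yes 1+k<m = α↗ (ℕ.n<1+n k) 1+k<m
    ... | yes _ | no  1+k≮m = ≡.subst (λ j → α j < hi)
      (≡.cong ℕ.pred (≡.sym (ℕ.≤∧≮⇒≡ k<m 1+k≮m))) α<hi
    ... | no  k≮m | _ = contradiction k<m k≮m
    e-sign : ∀ k → k ℕ.≤ suc m → 0# < sgn (suc m ∸ k) * eval p (e k)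
    e-sign zero    _         = lo-sign
    e-sign (suc k) (s≤s k≤m) with k ℕ.<? m
    ... | yes k<m = sign k k<m
    ... | no  k≮m = ≡.subst (λ j → 0# < sgn j * eval p hi)
      (≡.sym (≡.trans (≡.cong (m ∸_) (ℕ.≤∧≮⇒≡ k≤m k≮m)) (ℕ.n∸n≡0 m))) hi-sign
    roots = interlacing-roots (suc m) (suc m) p e lead e↗ e-sign

  roots-from-signs : ∀ m p α → HasPosLead (suc m) p → Increasing m α →
    (∀ k → k ℕ.< m → 0# < sgn (m ∸ k) * eval p (α k)) → ∃[ β ] IncreasingRoots (suc m) p β
  roots-from-signs m p α lead α↗ sign = roots-between m p α lo hi lead α↗ sign
    (<-≤-trans lo<min (min≤x (α 0) hi)) (<-≤-trans lo<min (min≤y (α 0) hi)) (proj₁ (proj₂ right-end))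
    (proj₂ (proj₂ left-end)) (proj₂ (proj₂ right-end))
    where
    right-end = pos-right (suc m) p (α (ℕ.pred m)) lead
    hi = proj₁ right-end
    left-end = pos-left (suc m) p (min (α 0) hi) lead
    lo = proj₁ left-end
    lo<min = proj₁ (proj₂ left-end)

  cons : Carrier → (ℕ → Carrier) → ℕ → Carrier
  cons x γ zero    = x
  cons x γ (suc k) = γ k

  cons-increasing : ∀ m x γ → (∀ k → k ℕ.< m → x < γ k) → Increasing m γ → Increasing (suc m) (cons x γ)
  cons-increasing m x γ x<γ γ↗ {zero}  {suc j} _         (s≤s j<m) = x<γ j j<m
  cons-increasing m x γ x<γ γ↗ {suc i} {suc j} (s≤s i<j) (s≤s j<m) = γ↗ i<j j<m

  -- Apartness of `x` from every entry makes each comparison decidable. The last component records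
  -- where the values come from, so that properties of the entries carry over.
  insert : ∀ m x γ → Increasing m γ → (∀ k → k ℕ.< m → x # γ k) →
    ∃[ γ′ ] (Increasing (suc m) γ′ ×
      (∀ k → k ℕ.< suc m → γ′ k ≡ x ⊎ (∃[ j ] (j ℕ.< m × γ′ k ≡ γ j))))
  insert zero    x γ _  _   = (λ _ → x) , (λ { {zero} {zero} () _ ; {_} {suc _} _ (s≤s ()) }) , λ _ _ → inj₁ ≡.refl
  insert (suc m) x γ γ↗ x#γ =
    [ first , later (insert m x (γ ∘ suc) (tail-increasing {β = γ} γ↗) (λ k k<m → x#γ (suc k) (s≤s k<m))) ]′
      (#⇒<⊎> (x#γ 0 (s≤s z≤n)))
    where
    Inserted : ℕ → (ℕ → Carrier) → Set _
    Inserted m γ = ∃[ γ′ ] (Increasing (suc m) γ′ ×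
      (∀ k → k ℕ.< suc m → γ′ k ≡ x ⊎ (∃[ j ] (j ℕ.< m × γ′ k ≡ γ j))))
    first : x < γ 0 → Inserted (suc m) γ
    first x<γ₀ = cons x γ , cons-increasing (suc m) x γ below γ↗
      , λ { zero _ → inj₁ ≡.refl ; (suc k) (s≤s k<m) → inj₂ (k , k<m , ≡.refl) }
      where
      below : ∀ k → k ℕ.< suc m → x < γ k
      below zero    _   = x<γ₀
      below (suc k) k<m = <-trans x<γ₀ (γ↗ (s≤s z≤n) k<m)
    later : Inserted m (γ ∘ suc) → γ 0 < x → Inserted (suc m) γ
    later (γ′ , γ′↗ , origin) γ₀<x = cons (γ 0) γ′ , cons-increasing (suc m) (γ 0) γ′ below γ′↗ , λ
      { zero    _         → inj₂ (0 , s≤s z≤n , ≡.refl)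
      ; (suc k) (s≤s k≤m) → [ inj₁ , (λ { (j , j<m , eq) → inj₂ (suc j , s≤s j<m , eq) }) ]′ (origin k k≤m) }
      where
      below : ∀ k → k ℕ.< suc m → γ 0 < γ′ k
      below k k≤m =
        [ (λ eq → ≡.subst (γ 0 <_) (≡.sym eq) γ₀<x)
        , (λ { (j , j<m , eq) → ≡.subst (γ 0 <_) (≡.sym eq) (γ↗ (s≤s z≤n) (s≤s j<m)) }) ]′ (origin k k≤m)

  -- Insertion sort; pairwise apartness stands in for a decidable order.
  sort : ∀ m (α : Fin m → Carrier) → (∀ j k → ¬ j ≡ k → α j # α k) →
    ∃[ γ ] (Increasing m γ × (∀ k → k ℕ.< m → ∃[ j ] γ k ≡ α j))
  sort zero    α _  = (λ _ → 0#) , (λ _ ()) , λ _ ()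
  sort (suc m) α α# = step (sort m (α ∘ Fin.suc) (λ j k j≢k → α# _ _ (j≢k ∘ Fin.suc-injective)))
    where
    step : ∃[ γ ] (Increasing m γ × (∀ k → k ℕ.< m → ∃[ j ] γ k ≡ α (Fin.suc j))) →
      ∃[ γ ] (Increasing (suc m) γ × (∀ k → k ℕ.< suc m → ∃[ j ] γ k ≡ α j))
    step (γ , γ↗ , origin) = proj₁ inserted , proj₁ (proj₂ inserted) , λ k k≤m →
      [ (λ eq → Fin.zero , eq)
      , (λ { (i , i<m , eq) → Fin.suc (proj₁ (origin i i<m)) , ≡.trans eq (proj₂ (origin i i<m)) }) ]′
        (proj₂ (proj₂ inserted) k k≤m)
      where
      inserted = insert m (α Fin.zero) γ γ↗ λ k k<m →
        ≡.subst (α Fin.zero #_) (≡.sym (proj₂ (origin k k<m))) (α# _ _ λ ())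

-- Alternating signs versus the maxima and minima of the statement.

module Alternation {c ℓ₁ ℓ₂} (ℝ : Reals c ℓ₁ ℓ₂) where
  open Reals ℝ
  open RealPolynomials ℝ
  open Order ℝ
  open Signs ℝ

  foldRange-max-< : ∀ lo d f {z} → (∀ k → lo ℕ.≤ k → k ℕ.≤ lo ℕ.+ d → f k < z) →
    foldRange max lo d f < z
  foldRange-max-< lo zero    f f<z = f<z lo ℕ.≤-refl (ℕ.m≤m+n lo 0)
  foldRange-max-< lo (suc d) f f<z = max-< (f<z lo ℕ.≤-refl (ℕ.m≤m+n lo (suc d)))
    (foldRange-max-< (suc lo) d f λ k lo<k k≤ →
      f<z k (ℕ.<⇒≤ lo<k) (ℕ.≤-trans k≤ (ℕ.≤-reflexive (≡.sym (ℕ.+-suc lo d)))))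

  foldRange-max-<⁻ : ∀ lo d f {z} → foldRange max lo d f < z →
    ∀ k → lo ℕ.≤ k → k ℕ.≤ lo ℕ.+ d → f k < z
  foldRange-max-<⁻ lo zero    f max<z k lo≤k k≤ =
    ≡.subst (λ j → f j < _) (ℕ.≤-antisym lo≤k (ℕ.≤-trans k≤ (ℕ.≤-reflexive (ℕ.+-identityʳ lo)))) max<z
  foldRange-max-<⁻ lo (suc d) f max<z k lo≤k k≤ =
    [ (λ lo<k → foldRange-max-<⁻ (suc lo) d f (≤-<-trans (y≤max _ _) max<z) k lo<k
        (ℕ.≤-trans k≤ (ℕ.≤-reflexive (ℕ.+-suc lo d))))
    , (λ { ≡.refl → ≤-<-trans (x≤max _ _) max<z }) ]′ (ℕ.m≤n⇒m<n∨m≡n lo≤k)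

  foldRange-<-min : ∀ lo d f {z} → (∀ k → lo ℕ.≤ k → k ℕ.≤ lo ℕ.+ d → z < f k) →
    z < foldRange min lo d f
  foldRange-<-min lo zero    f z<f = z<f lo ℕ.≤-refl (ℕ.m≤m+n lo 0)
  foldRange-<-min lo (suc d) f z<f = <-min (z<f lo ℕ.≤-refl (ℕ.m≤m+n lo (suc d)))
    (foldRange-<-min (suc lo) d f λ k lo<k k≤ →
      z<f k (ℕ.<⇒≤ lo<k) (ℕ.≤-trans k≤ (ℕ.≤-reflexive (≡.sym (ℕ.+-suc lo d)))))

  foldRange-<-min⁻ : ∀ lo d f {z} → z < foldRange min lo d f →
    ∀ k → lo ℕ.≤ k → k ℕ.≤ lo ℕ.+ d → z < f k
  foldRange-<-min⁻ lo zero    f z<min k lo≤k k≤ =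
    ≡.subst (λ j → _ < f j) (ℕ.≤-antisym lo≤k (ℕ.≤-trans k≤ (ℕ.≤-reflexive (ℕ.+-identityʳ lo)))) z<min
  foldRange-<-min⁻ lo (suc d) f z<min k lo≤k k≤ =
    [ (λ lo<k → foldRange-<-min⁻ (suc lo) d f (<-≤-trans z<min (min≤y _ _)) k lo<k
        (ℕ.≤-trans k≤ (ℕ.≤-reflexive (ℕ.+-suc lo d))))
    , (λ { ≡.refl → <-≤-trans z<min (min≤x _ _) }) ]′ (ℕ.m≤n⇒m<n∨m≡n lo≤k)

  range : ∀ {lo hi k} → lo ℕ.≤ hi → k ℕ.≤ hi → k ℕ.≤ lo ℕ.+ (hi ∸ lo)
  range lo≤hi k≤hi = ℕ.≤-trans k≤hi (ℕ.≤-reflexive (≡.sym (ℕ.m+[n∸m]≡n lo≤hi)))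

  range⁻ : ∀ {lo hi k} → lo ℕ.≤ hi → k ℕ.≤ lo ℕ.+ (hi ∸ lo) → k ℕ.≤ hi
  range⁻ lo≤hi k≤ = ℕ.≤-trans k≤ (ℕ.≤-reflexive (ℕ.m+[n∸m]≡n lo≤hi))

  sgn-homo-+ : ∀ i j → sgn (i ℕ.+ j) ≈ sgn i * sgn j
  sgn-homo-+ zero    j = sym (*-identityˡ _)
  sgn-homo-+ (suc i) j = trans (-‿cong (sgn-homo-+ i j)) (neg-* (sgn i) (sgn j))
    where
    neg-* : ∀ s t → - (s * t) ≈ - s * t
    neg-* = solve 2 (λ s t → :- (s :* t) := :- s :* t) refl

  sgn-square : ∀ i → sgn i * sgn i ≈ 1#
  sgn-square zero    = *-identityˡ 1#
  sgn-square (suc i) = trans (neg-*-neg (sgn i)) (sgn-square i)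
    where
    neg-*-neg : ∀ s → - s * - s ≈ s * s
    neg-*-neg = solve 1 (λ s → :- s :* :- s := s :* s) refl

  sgn-even : ∀ q → sgn (2 ℕ.* q) ≈ 1#
  sgn-even q = trans (sgn-homo-+ q (q ℕ.+ 0))
    (trans (*-congˡ (reflexive (≡.cong sgn (ℕ.+-identityʳ q)))) (sgn-square q))

  sgn-odd : ∀ q → sgn (2 ℕ.* q ℕ.+ 1) ≈ - 1#
  sgn-odd q = trans (sgn-homo-+ (2 ℕ.* q) 1) (trans (*-congʳ (sgn-even q)) (*-identityˡ _))

  sgn-∸ : ∀ {i k} → k ℕ.≤ i → sgn (i ∸ k) ≈ sgn i * sgn k
  sgn-∸ {i} {k} k≤i = begin
    sgn (i ∸ k)                       ≈⟨ *-identityʳ _ ⟨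
    sgn (i ∸ k) * 1#                  ≈⟨ *-congˡ (sgn-square k) ⟨
    sgn (i ∸ k) * (sgn k * sgn k)     ≈⟨ *-assoc _ _ _ ⟨
    sgn (i ∸ k) * sgn k * sgn k       ≈⟨ *-congʳ (sgn-homo-+ (i ∸ k) k) ⟨
    sgn (i ∸ k ℕ.+ k) * sgn k         ≈⟨ *-congʳ (reflexive (≡.cong sgn (ℕ.m∸n+n≡m k≤i))) ⟩
    sgn i * sgn k                     ∎
    where open SetoidReasoning setoid

  parity : ∀ i → ∃[ q ] (i ≡ 2 ℕ.* q ⊎ i ≡ 2 ℕ.* q ℕ.+ 1)
  parity zero    = 0 , inj₁ ≡.refl
  parity (suc i) = step (parity i)
    where
    step : ∃[ q ] (i ≡ 2 ℕ.* q ⊎ i ≡ 2 ℕ.* q ℕ.+ 1) → ∃[ q ] (suc i ≡ 2 ℕ.* q ⊎ suc i ≡ 2 ℕ.* q ℕ.+ 1)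
    step (q , inj₁ ≡.refl) = q , inj₂ (ℕ.+-comm 1 (2 ℕ.* q))
    step (q , inj₂ ≡.refl) = suc q , inj₁ (≡.trans (≡.cong suc (ℕ.+-comm (2 ℕ.* q) 1))
      (≡.sym (ℕ.*-suc 2 q)))

  odd⇒2∤ : ∀ q → 2 ∤ 2 ℕ.* q ℕ.+ 1
  odd⇒2∤ q 2∣ with () ← ∣1⇒≡1 (∣m+n∣m⇒∣n {2} {2 ℕ.* q} {1} 2∣ (m∣m*n q))

  -- For `y = b i` and `g k` the value of `R⁰` at `α k`, the difference `y - g k` is the value of
  -- `P i` at the `k`-th root of `P (i ∸ 1)`, numbered from 1.
  Alternating : ℕ → Carrier → (ℕ → Carrier) → Set ℓ₂
  Alternating i y g = ∀ k → 1 ℕ.≤ k → k ℕ.< i → 0# < sgn (i ∸ k) * (y - g k)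

  module _ {s y z : Carrier} where
    +⇒< : s ≈ 1# → 0# < s * (y - z) → z < y
    +⇒< s≈1 0<sd = 0<y-x⇒x<y (<-respʳ-≈ (trans (*-congʳ s≈1) (*-identityˡ _)) 0<sd)

    <⇒+ : s ≈ 1# → z < y → 0# < s * (y - z)
    <⇒+ s≈1 z<y = <-respʳ-≈ (sym (trans (*-congʳ s≈1) (*-identityˡ _))) (x<y⇒0<y-x z<y)

    private
      swap : ∀ y z → - 1# * (y - z) ≈ z - y
      swap = solve 2 (λ y z → :- con (ℤ.+ 1) :* (y :- z) := z :- y) refl

    -⇒> : s ≈ - 1# → 0# < s * (y - z) → y < z
    -⇒> s≈-1 0<sd = 0<y-x⇒x<y (<-respʳ-≈ (trans (*-congʳ s≈-1) (swap y z)) 0<sd)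

    >⇒- : s ≈ - 1# → y < z → 0# < s * (y - z)
    >⇒- s≈-1 y<z = <-respʳ-≈ (sym (trans (*-congʳ s≈-1) (swap y z))) (x<y⇒0<y-x y<z)

  sgn-product : ∀ i k {s t u} → k ℕ.< i → sgn i ≈ s → sgn k ≈ t → s * t ≈ u → sgn (i ∸ k) ≈ u
  sgn-product i k k<i sᵢ sₖ st≈u = trans (sgn-∸ (ℕ.<⇒≤ k<i)) (trans (*-cong sᵢ sₖ) st≈u)

  -1*-1≈1 : - 1# * - 1# ≈ 1#
  -1*-1≈1 = solve 0 (:- con (ℤ.+ 1) :* :- con (ℤ.+ 1) := con (ℤ.+ 1)) refl

  -- For even `i` the sign `sgn (i ∸ k)` is positive at even `k` and negative at odd `k`, which puts
  -- `g` below `y` and above `y` respectively. The bound on `h` keeps the range `1 ⋯ N` nonempty: on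
  -- an empty range, truncated subtraction would still make the fold return the value at its lower
  -- end.
  module Even (h : ℕ) (2≤h : 2 ℕ.≤ h) {i N : ℕ} (i≡2h : i ≡ 2 ℕ.* h) (N≡h-1 : N ≡ h ∸ 1)
              (y : Carrier) (g : ℕ → Carrier) where
    private
      1≤N : 1 ℕ.≤ N
      1≤N = ≡.subst (1 ℕ.≤_) (≡.sym N≡h-1) (ℕ.∸-monoˡ-≤ 1 2≤h)
      sᵢ : sgn i ≈ 1#
      sᵢ = trans (reflexive (≡.cong sgn i≡2h)) (sgn-even h)
      h≡1+N : h ≡ suc N
      h≡1+N = ≡.sym (≡.trans (≡.cong suc N≡h-1) (ℕ.m+[n∸m]≡n (ℕ.≤-trans (s≤s z≤n) 2≤h)))
      bound : ∀ {k} → k ℕ.≤ N → 2 ℕ.* k ℕ.+ 1 ℕ.< i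
      bound {k} k≤N = begin-strict
        2 ℕ.* k ℕ.+ 1      <⟨ ℕ.+-monoʳ-< (2 ℕ.* k) (s≤s (s≤s z≤n)) ⟩
        2 ℕ.* k ℕ.+ 2      ≡⟨ ≡.trans (ℕ.+-comm (2 ℕ.* k) 2) (≡.sym (ℕ.*-suc 2 k)) ⟩
        2 ℕ.* suc k        ≤⟨ ℕ.*-monoʳ-≤ 2 (s≤s k≤N) ⟩
        2 ℕ.* suc N        ≡⟨ ≡.cong (2 ℕ.*_) h≡1+N ⟨
        2 ℕ.* h            ≡⟨ i≡2h ⟨
        i                  ∎
        where open ℕ.≤-Reasoning
      bound⁻ : ∀ {k} → 2 ℕ.* k ℕ.< i → k ℕ.≤ N
      bound⁻ {k} 2k<i = ℕ.≤-pred (≡.subst (k ℕ.<_) h≡1+N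
        (ℕ.*-cancelˡ-< 2 k h (≡.subst (2 ℕ.* k ℕ.<_) i≡2h 2k<i)))

    endpoints : Alternating i y g →
      max[ 1 ⋯ N ] (λ k → g (2 ℕ.* k)) < y × y < min[ 0 ⋯ N ] (λ k → g (2 ℕ.* k ℕ.+ 1))
    endpoints alt =
      foldRange-max-< 1 (N ∸ 1) _ (λ k 1≤k k≤ → let k<i = ℕ.≤-<-trans (ℕ.m≤m+n _ 1) (bound (range⁻ 1≤N k≤)) in
        +⇒< (sgn-product i (2 ℕ.* k) k<i sᵢ (sgn-even k) (*-identityˡ 1#))
          (alt (2 ℕ.* k) (ℕ.≤-trans 1≤k (ℕ.m≤n*m k 2)) k<i)) ,
      foldRange-<-min 0 N _ (λ k _ k≤ → let k<i = bound k≤ in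
        -⇒> (sgn-product i (2 ℕ.* k ℕ.+ 1) k<i sᵢ (sgn-odd k) (*-identityˡ _))
          (alt (2 ℕ.* k ℕ.+ 1) (ℕ.m≤n+m 1 (2 ℕ.* k)) k<i))

    alternating : max[ 1 ⋯ N ] (λ k → g (2 ℕ.* k)) < y × y < min[ 0 ⋯ N ] (λ k → g (2 ℕ.* k ℕ.+ 1)) →
      Alternating i y g
    alternating (max<y , y<min) k 1≤k k<i with parity k
    ... | q , inj₁ ≡.refl = <⇒+ (sgn-product i (2 ℕ.* q) k<i sᵢ (sgn-even q) (*-identityˡ 1#))
          (foldRange-max-<⁻ 1 (N ∸ 1) _ max<y q (ℕ.*-cancelˡ-< 2 0 q 1≤k) (range 1≤N (bound⁻ k<i)))
    ... | q , inj₂ ≡.refl = >⇒- (sgn-product i (2 ℕ.* q ℕ.+ 1) k<i sᵢ (sgn-odd q) (*-identityˡ _))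
          (foldRange-<-min⁻ 0 N _ y<min q z≤n (bound⁻ (ℕ.≤-<-trans (ℕ.m≤m+n _ 1) k<i)))

  -- For odd `i` the roles of even and odd `k` are exchanged, and the two ranges end at different
  -- indices: `M` for the odd positions, `N` for the even ones.
  module Odd (h : ℕ) (1≤h : 1 ℕ.≤ h) {i M N : ℕ} (i≡2h+1 : i ≡ 2 ℕ.* h ℕ.+ 1) (M≡h-1 : M ≡ h ∸ 1) (N≡h : N ≡ h)
             (y : Carrier) (g : ℕ → Carrier) where
    private
      1≤N : 1 ℕ.≤ N
      1≤N = ≡.subst (1 ℕ.≤_) (≡.sym N≡h) 1≤h
      sᵢ : sgn i ≈ - 1#
      sᵢ = trans (reflexive (≡.cong sgn i≡2h+1)) (sgn-odd h)
      h≡1+M : h ≡ suc M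
      h≡1+M = ≡.sym (≡.trans (≡.cong suc M≡h-1) (ℕ.m+[n∸m]≡n 1≤h))
      even-bound : ∀ {k} → k ℕ.≤ N → 2 ℕ.* k ℕ.< i
      even-bound {k} k≤N = begin-strict
        2 ℕ.* k        ≤⟨ ℕ.*-monoʳ-≤ 2 k≤N ⟩
        2 ℕ.* N        ≡⟨ ≡.cong (2 ℕ.*_) N≡h ⟩
        2 ℕ.* h        <⟨ ℕ.m<m+n (2 ℕ.* h) (s≤s z≤n) ⟩
        2 ℕ.* h ℕ.+ 1  ≡⟨ i≡2h+1 ⟨
        i              ∎
        where open ℕ.≤-Reasoning
      even-bound⁻ : ∀ {k} → 2 ℕ.* k ℕ.< i → k ℕ.≤ N
      even-bound⁻ {k} 2k<i = ≡.subst (k ℕ.≤_) (≡.sym N≡h) (ℕ.*-cancelˡ-≤ 2 (ℕ.≤-pred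
        (≡.subst (2 ℕ.* k ℕ.<_) (≡.trans i≡2h+1 (ℕ.+-comm (2 ℕ.* h) 1)) 2k<i)))
      odd-bound : ∀ {k} → k ℕ.≤ M → 2 ℕ.* k ℕ.+ 1 ℕ.< i
      odd-bound {k} k≤M = ≡.subst (2 ℕ.* k ℕ.+ 1 ℕ.<_) (≡.sym i≡2h+1)
        (ℕ.+-monoˡ-< 1 (ℕ.*-monoʳ-< 2 (≡.subst (k ℕ.<_) (≡.sym h≡1+M) (s≤s k≤M))))
      odd-bound⁻ : ∀ {k} → 2 ℕ.* k ℕ.+ 1 ℕ.< i → k ℕ.≤ M
      odd-bound⁻ {k} 2k+1<i = ℕ.≤-pred (≡.subst (k ℕ.<_) h≡1+M (ℕ.*-cancelˡ-< 2 k h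
        (ℕ.+-cancelʳ-< 1 (2 ℕ.* k) (2 ℕ.* h) (≡.subst (2 ℕ.* k ℕ.+ 1 ℕ.<_) i≡2h+1 2k+1<i))))

    endpoints : Alternating i y g →
      max[ 0 ⋯ M ] (λ k → g (2 ℕ.* k ℕ.+ 1)) < y × y < min[ 1 ⋯ N ] (λ k → g (2 ℕ.* k))
    endpoints alt =
      foldRange-max-< 0 M _ (λ k _ k≤ → let k<i = odd-bound k≤ in
        +⇒< (sgn-product i (2 ℕ.* k ℕ.+ 1) k<i sᵢ (sgn-odd k) -1*-1≈1)
          (alt (2 ℕ.* k ℕ.+ 1) (ℕ.m≤n+m 1 (2 ℕ.* k)) k<i)) ,
      foldRange-<-min 1 (N ∸ 1) _ (λ k 1≤k k≤ → let k<i = even-bound (range⁻ 1≤N k≤) in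
        -⇒> (sgn-product i (2 ℕ.* k) k<i sᵢ (sgn-even k) (*-identityʳ _))
          (alt (2 ℕ.* k) (ℕ.≤-trans 1≤k (ℕ.m≤n*m k 2)) k<i))

    alternating : max[ 0 ⋯ M ] (λ k → g (2 ℕ.* k ℕ.+ 1)) < y × y < min[ 1 ⋯ N ] (λ k → g (2 ℕ.* k)) →
      Alternating i y g
    alternating (max<y , y<min) k 1≤k k<i with parity k
    ... | q , inj₁ ≡.refl = >⇒- (sgn-product i (2 ℕ.* q) k<i sᵢ (sgn-even q) (*-identityʳ _))
          (foldRange-<-min⁻ 1 (N ∸ 1) _ y<min q (ℕ.*-cancelˡ-< 2 0 q 1≤k) (range 1≤N (even-bound⁻ k<i)))
    ... | q , inj₂ ≡.refl = <⇒+ (sgn-product i (2 ℕ.* q ℕ.+ 1) k<i sᵢ (sgn-odd q) -1*-1≈1)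
          (foldRange-max-<⁻ 0 M _ max<y q z≤n (odd-bound⁻ k<i))

  half-even : ∀ h → (2 ℕ.* h ∸ 2) ℕ./ 2 ≡ h ∸ 1
  half-even h = ≡.trans (≡.cong (ℕ._/ 2) (≡.trans (≡.cong (_∸ 2) (ℕ.*-comm 2 h)) (≡.sym (ℕ.*-distribʳ-∸ 2 h 1))))
    (m*n/n≡m (h ∸ 1) 2)

  half-odd : ∀ h → (2 ℕ.* h ℕ.+ 1 ∸ 1) ℕ./ 2 ≡ h
  half-odd h = ≡.trans (≡.cong (ℕ._/ 2) (≡.trans (ℕ.m+n∸n≡m (2 ℕ.* h) 1) (ℕ.*-comm 2 h))) (m*n/n≡m h 2)

  half-odd-pred : ∀ h → (2 ℕ.* h ℕ.+ 1 ∸ 3) ℕ./ 2 ≡ h ∸ 1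
  half-odd-pred h = ≡.trans (≡.cong (λ k → (k ∸ 3) ℕ./ 2) (ℕ.+-comm (2 ℕ.* h) 1)) (half-even h)

  2≤half : ∀ {h i} → i ≡ 2 ℕ.* h → 3 ℕ.≤ i → 2 ℕ.≤ h
  2≤half {h} i≡2h 3≤i = ℕ.*-cancelˡ-< 2 1 h (≡.subst (3 ℕ.≤_) i≡2h 3≤i)

  1≤half : ∀ {h i} → i ≡ 2 ℕ.* h ℕ.+ 1 → 3 ℕ.≤ i → 1 ℕ.≤ h
  1≤half {zero}  ≡.refl (s≤s ())
  1≤half {suc h} _      _ = s≤s z≤n

  module _ (n : ℕ) (p : Poly) where

    alternating⇒endpoints : ∀ i α → 3 ℕ.≤ i →
      Alternating i (b n p i) (λ k → eval (R⁰ n p (i ∸ 2)) (α k)) →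
      Endpoints n p (λ l u → l < b n p i × b n p i < u) i α
    alternating⇒endpoints i α 3≤i alt = even , odd
      where
      g : ℕ → Carrier
      g k = eval (R⁰ n p (i ∸ 2)) (α k)
      even : 2 ∣ i → _
      even (divides h i≡h*2) = Even.endpoints h (2≤half i≡2h 3≤i) i≡2h
        (≡.trans (≡.cong (λ j → (j ∸ 2) ℕ./ 2) i≡2h) (half-even h)) (b n p i) g alt
        where
        i≡2h = ≡.trans i≡h*2 (ℕ.*-comm h 2)
      odd : 2 ∤ i → _
      odd 2∤i with parity i
      ... | h , inj₁ i≡2h   = contradiction (divides h (≡.trans i≡2h (ℕ.*-comm 2 h))) 2∤i
      ... | h , inj₂ i≡2h+1 = Odd.endpoints h (1≤half i≡2h+1 3≤i) i≡2h+1
        (≡.trans (≡.cong (λ j → (j ∸ 3) ℕ./ 2) i≡2h+1) (half-odd-pred h))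
        (≡.trans (≡.cong (λ j → (j ∸ 1) ℕ./ 2) i≡2h+1) (half-odd h)) (b n p i) g alt

    endpoints⇒alternating : ∀ i α → 3 ℕ.≤ i →
      Endpoints n p (λ l u → l < b n p i × b n p i < u) i α →
      Alternating i (b n p i) (λ k → eval (R⁰ n p (i ∸ 2)) (α k))
    endpoints⇒alternating i α 3≤i (even , odd) = cases (parity i)
      where
      g : ℕ → Carrier
      g k = eval (R⁰ n p (i ∸ 2)) (α k)
      cases : ∃[ h ] (i ≡ 2 ℕ.* h ⊎ i ≡ 2 ℕ.* h ℕ.+ 1) → Alternating i (b n p i) g
      cases (h , inj₁ i≡2h) = Even.alternating h (2≤half i≡2h 3≤i) i≡2h
        (≡.trans (≡.cong (λ j → (j ∸ 2) ℕ./ 2) i≡2h) (half-even h)) (b n p i) g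
        (even (divides h (≡.trans i≡2h (ℕ.*-comm 2 h))))
      cases (h , inj₂ i≡2h+1) = Odd.alternating h (1≤half i≡2h+1 3≤i) i≡2h+1
        (≡.trans (≡.cong (λ j → (j ∸ 3) ℕ./ 2) i≡2h+1) (half-odd-pred h))
        (≡.trans (≡.cong (λ j → (j ∸ 1) ℕ./ 2) i≡2h+1) (half-odd h)) (b n p i) g
        (odd (≡.subst (2 ∤_) (≡.sym i≡2h+1) (odd⇒2∤ h)))

-- The family `P i` and the two implications.

module Derivatives {c ℓ₁ ℓ₂} (ℝ : Reals c ℓ₁ ℓ₂) where
  open Reals ℝ
  open RealPolynomials ℝ
  open Order ℝ
  open PolynomialProperties ℝ
  open Signs ℝ
  open RootConstruction ℝ
  open Alternation ℝ

  /ℕ-pos : ∀ {x} k .{{_ : ℕ.NonZero k}} → 0# < x → 0# < x /ℕ k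
  /ℕ-pos {x} k 0<x = *-pos 0<x (*-cancelˡ-pos (fromℕ-pos k) (<-respʳ-≈ (sym k*k⁻¹≈1) 0<1))
    where
    k#0 = Equivalence.from (#⇔<⊎> (fromℕ k) 0#) (inj₂ (fromℕ-pos k))
    regroup : ∀ k r → k * r ≈ r * (k - 0#)
    regroup = solve 2 (λ k r → k :* r := r :* (k :- con (ℤ.+ 0))) refl
    k*k⁻¹≈1 : fromℕ k * recip k#0 ≈ 1#
    k*k⁻¹≈1 = trans (regroup (fromℕ k) (recip k#0)) (proj₁ (proj₂ (#⇒invertible k#0)))

  roots-⊆ : ∀ {m} p q β → (∀ x → eval p x ≈ 0# → eval q x ≈ 0#) →
    IncreasingRoots m p β → IncreasingRoots m q β
  roots-⊆ p q β p⇒q (root , β↗) = (λ j<m → p⇒q (β _) (root j<m)) , β↗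

  scale-root : ∀ a p {x} → eval p x ≈ 0# → eval (scale a p) x ≈ 0#
  scale-root a p p[x]≈0 = trans (eval-scale a p _) (trans (*-congˡ p[x]≈0) (zeroʳ a))

  scale-root⁻ : ∀ {a} p {x} → 0# < a → eval (scale a p) x ≈ 0# → eval p x ≈ 0#
  scale-root⁻ {a} p 0<a ap[x]≈0 = *≈0⇒≈0 (>⇒# 0<a) (trans (sym (eval-scale a p _)) ap[x]≈0)

  scale-lead : ∀ {a d} p → 0# < a → HasPosLead d p → HasPosLead d (scale a p)
  scale-lead {a} {d} p 0<a (deg , lead) =
    (λ j d<j → trans (coeff-scale a p j) (trans (*-congˡ (deg j d<j)) (zeroʳ a)))
    , <-respʳ-≈ (sym (coeff-scale a p d)) (*-pos 0<a lead)

  -- The factor is `(t + j)! / j!`; stating only its positivity avoids factorial arithmetic.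
  coeff-derivs : ∀ p t j → ∃[ a ] (0# < a × coeff (p ⁽ t ⁾) j ≈ a * coeff p (t ℕ.+ j))
  coeff-derivs p zero    j = 1# , 0<1 , sym (*-identityˡ _)
  coeff-derivs p (suc t) j = step (coeff-derivs p t (suc j))
    where
    ·-as-* : ∀ k y → k · y ≈ fromℕ k * y
    ·-as-* zero    y = sym (zeroˡ y)
    ·-as-* (suc k) y = trans (+-cong (sym (*-identityˡ y)) (·-as-* k y)) (sym (distribʳ y 1# (fromℕ k)))
    step : ∃[ a ] (0# < a × coeff (p ⁽ t ⁾) (suc j) ≈ a * coeff p (t ℕ.+ suc j)) →
      ∃[ a ] (0# < a × coeff (p ⁽ suc t ⁾) j ≈ a * coeff p (suc t ℕ.+ j))
    step (a , 0<a , eq) = fromℕ (suc j) * a , *-pos (fromℕ-pos (suc j)) 0<a , (begin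
      coeff (p ⁽ suc t ⁾) j                         ≈⟨ coeff-deriv (p ⁽ t ⁾) j ⟩
      suc j · coeff (p ⁽ t ⁾) (suc j)               ≈⟨ ·-as-* (suc j) _ ⟩
      fromℕ (suc j) * coeff (p ⁽ t ⁾) (suc j)       ≈⟨ *-congˡ eq ⟩
      fromℕ (suc j) * (a * coeff p (t ℕ.+ suc j))   ≈⟨ *-assoc _ _ _ ⟨
      fromℕ (suc j) * a * coeff p (t ℕ.+ suc j)     ≡⟨ ≡.cong (λ k → fromℕ (suc j) * a * coeff p k) (ℕ.+-suc t j) ⟩
      fromℕ (suc j) * a * coeff p (suc t ℕ.+ j)     ∎)
      where open SetoidReasoning setoid

  Roots : ℕ → Poly → Set _
  Roots m p = ∃[ β ] IncreasingRoots m p β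

  ordered⇒increasing : ∀ m p α → OrderedRoots m p α → IncreasingRoots m p (α ∘ suc)
  ordered⇒increasing m p α (root , α↗) = (λ j<m → root _ (s≤s z≤n) j<m)
    , adjacent⇒increasing m (α ∘ suc) λ k 1+k<m → α↗ (suc k) (s≤s z≤n) 1+k<m

  -- `OrderedRoots` counts from 1, so `0#` pads the ignored index 0.
  increasing⇒ordered : ∀ m p β → IncreasingRoots m p β → OrderedRoots m p (cons 0# β)
  increasing⇒ordered m p β (root , β↗) = root′ , cons↗
    where
    root′ : ∀ k → 1 ℕ.≤ k → k ℕ.≤ m → eval p (cons 0# β k) ≈ 0#
    root′ (suc k) _ k<m = root k<m
    cons↗ : ∀ k → 1 ℕ.≤ k → k ℕ.< m → cons 0# β k < cons 0# β (suc k)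
    cons↗ (suc k) _ 1+k<m = β↗ (ℕ.n<1+n k) 1+k<m

  distinct⇒roots : ∀ m p → HasDistinctRoots m p → Roots m p
  distinct⇒roots m p (α , root , α#) = γ , (λ k<m → γ-root _ k<m) , proj₁ (proj₂ sorted)
    where
    sorted = sort m α α#
    γ = proj₁ sorted
    γ-root : ∀ k → k ℕ.< m → eval p (γ k) ≈ 0#
    γ-root k k<m = trans (reflexive (≡.cong (eval p) (proj₂ (proj₂ (proj₂ sorted) k k<m)))) (root _)

  roots⇒distinct : ∀ m p → Roots m p → HasDistinctRoots m p
  roots⇒distinct m p (β , root , β↗) = β ∘ Fin.toℕ , (λ j → root (Fin.toℕ<n j)) , distinct
    where
    distinct : ∀ j k → ¬ j ≡ k → β (Fin.toℕ j) # β (Fin.toℕ k)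
    distinct j k j≢k with ℕ.<-cmp (Fin.toℕ j) (Fin.toℕ k)
    ... | tri< j<k _ _ = <⇒# (β↗ j<k (Fin.toℕ<n k))
    ... | tri≈ _ j≡k _ = contradiction (Fin.toℕ-injective j≡k) j≢k
    ... | tri> _ _ k<j = >⇒# (β↗ k<j (Fin.toℕ<n j))

  module Family (n : ℕ) (3≤n : 3 ℕ.≤ n) (Pₙ : Poly) (monic : IsMonic n Pₙ) (a₁≈0 : coeff Pₙ (n ∸ 1) ≈ 0#) where

    private instance
      n!-nonZero : ℕ.NonZero (n !)
      n!-nonZero = n ℕ.!≢0

    factor-pos : ∀ i → 0# < fromℕ (i !) /ℕ (n !)
    factor-pos i = /ℕ-pos (n !) (fromℕ-pos (i !) {{i ℕ.!≢0}})

    derivs-lead : ∀ t → t ℕ.≤ n → HasPosLead (n ∸ t) (Pₙ ⁽ t ⁾)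
    derivs-lead zero    _   = proj₂ monic , <-respʳ-≈ (sym (proj₁ monic)) 0<1
    derivs-lead (suc t) t<n = deriv-lead (n ∸ suc t) (Pₙ ⁽ t ⁾)
      (≡.subst (λ d → HasPosLead d (Pₙ ⁽ t ⁾)) (ℕ.+-∸-assoc 1 t<n) (derivs-lead t (ℕ.<⇒≤ t<n)))

    P-lead : ∀ i → i ℕ.≤ n → HasPosLead i (P n Pₙ i)
    P-lead i i≤n = scale-lead (Pₙ ⁽ n ∸ i ⁾) (factor-pos i)
      (≡.subst (λ d → HasPosLead d (Pₙ ⁽ n ∸ i ⁾)) (ℕ.m∸[m∸n]≡n i≤n) (derivs-lead (n ∸ i) (ℕ.m∸n≤m n i)))

    -- The constant term of the derivative of order `n - 1` is a multiple of the coefficient of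
    -- degree `n - 1`, which vanishes by assumption.
    P₁[0]≈0 : eval (P n Pₙ 1) 0# ≈ 0#
    P₁[0]≈0 = scale-root (fromℕ (1 !) /ℕ (n !)) (Pₙ ⁽ n ∸ 1 ⁾) (begin
      eval (Pₙ ⁽ n ∸ 1 ⁾) 0#                  ≈⟨ eval-at-0 (Pₙ ⁽ n ∸ 1 ⁾) ⟩
      coeff (Pₙ ⁽ n ∸ 1 ⁾) 0                  ≈⟨ proj₂ (proj₂ derivs) ⟩
      proj₁ derivs * coeff Pₙ (n ∸ 1 ℕ.+ 0)   ≡⟨ ≡.cong (λ j → proj₁ derivs * coeff Pₙ j) (ℕ.+-identityʳ (n ∸ 1)) ⟩
      proj₁ derivs * coeff Pₙ (n ∸ 1)         ≈⟨ *-congˡ a₁≈0 ⟩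
      proj₁ derivs * 0#                       ≈⟨ zeroʳ _ ⟩
      0#                                      ∎)
      where
      open SetoidReasoning setoid
      derivs = coeff-derivs Pₙ (n ∸ 1) 0

    P₂[0]≈ : ∃[ a ] (0# < a × eval (P n Pₙ 2) 0# ≈ a * coeff Pₙ (n ∸ 2))
    P₂[0]≈ = f * proj₁ derivs , *-pos (factor-pos 2) (proj₁ (proj₂ derivs)) , (begin
      eval (P n Pₙ 2) 0#                            ≈⟨ eval-scale f (Pₙ ⁽ n ∸ 2 ⁾) 0# ⟩
      f * eval (Pₙ ⁽ n ∸ 2 ⁾) 0#                    ≈⟨ *-congˡ (eval-at-0 (Pₙ ⁽ n ∸ 2 ⁾)) ⟩
      f * coeff (Pₙ ⁽ n ∸ 2 ⁾) 0                    ≈⟨ *-congˡ (proj₂ (proj₂ derivs)) ⟩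
      f * (proj₁ derivs * coeff Pₙ (n ∸ 2 ℕ.+ 0))   ≡⟨ ≡.cong (λ j → f * (proj₁ derivs * coeff Pₙ j)) (ℕ.+-identityʳ (n ∸ 2)) ⟩
      f * (proj₁ derivs * coeff Pₙ (n ∸ 2))         ≈⟨ *-assoc _ _ _ ⟨
      f * proj₁ derivs * coeff Pₙ (n ∸ 2)           ∎)
      where
      open SetoidReasoning setoid
      f = fromℕ (2 !) /ℕ (n !)
      derivs = coeff-derivs Pₙ (n ∸ 2) 0

    zero-root : IncreasingRoots 1 (P n Pₙ 1) (λ _ → 0#)
    zero-root = (λ _ → P₁[0]≈0) , λ { {zero} {zero} () _ ; {_} {suc _} _ (s≤s ()) }

    -- For `m = 1` this is interchangeable with `coeff Pₙ (n ∸ 2) < 0#`, and for `2 ≤ m` with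
    -- `Condition n Pₙ (suc m)`.
    SignCondition : ℕ → Set _
    SignCondition m = ∀ α → IncreasingRoots m (P n Pₙ m) α →
      ∀ k → k ℕ.< m → 0# < sgn (m ∸ k) * eval (P n Pₙ (suc m)) (α k)

    P-deriv : ∀ {m} → m ℕ.< n → Pₙ ⁽ n ∸ m ⁾ ≡ deriv (Pₙ ⁽ n ∸ suc m ⁾)
    P-deriv m<n = ≡.cong (Pₙ ⁽_⁾) (ℕ.+-∸-assoc 1 m<n)

    -- Rolle's theorem yields roots `γ` of `P m` with `β k < γ k < β (suc k)`, so the number of
    -- roots of `P (suc m)` below `γ k` is known and determines the sign. Any other enumeration `α`
    -- has the same values as `γ`.
    descend : ∀ m → m ℕ.< n → Roots (suc m) (P n Pₙ (suc m)) → Roots m (P n Pₙ m) × SignCondition m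
    descend m m<n (β , β-roots) = (γ , γ-roots) , sign
      where
      q = Pₙ ⁽ n ∸ suc m ⁾
      β-roots′ : IncreasingRoots (suc m) q β
      β-roots′ = roots-⊆ (P n Pₙ (suc m)) q β (λ _ → scale-root⁻ q (factor-pos (suc m))) β-roots
      q-lead : HasPosLead (suc m) q
      q-lead = ≡.subst (λ d → HasPosLead d q) (ℕ.m∸[m∸n]≡n m<n) (derivs-lead (n ∸ suc m) (ℕ.m∸n≤m n (suc m)))
      rolle-roots = rolle m q β q-lead β-roots′
      γ = proj₁ rolle-roots
      γ-roots : IncreasingRoots m (P n Pₙ m) γ
      γ-roots = roots-⊆ (deriv q) (P n Pₙ m) γ
        (λ x q′[x]≈0 → scale-root _ (Pₙ ⁽ n ∸ m ⁾) (trans (reflexive (≡.cong (λ r → eval r x) (P-deriv m<n))) q′[x]≈0))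
        (proj₁ (proj₂ rolle-roots))
      β≤ : ∀ {i j} → i ℕ.≤ j → j ℕ.< suc m → β i ≤ β j
      β≤ = increasing-≤ β (proj₂ β-roots)
      sign : SignCondition m
      sign α α-roots k k<m = <-respʳ-≈
        (*-congˡ (eval-cong (P n Pₙ (suc m)) (roots-unique m (P n Pₙ m) γ α (P-lead m (ℕ.<⇒≤ m<n)) γ-roots α-roots k<m)))
        -- Exactly `suc k` of the `suc m` roots lie below `γ k`, and `suc m ∸ suc k` reduces to the
        -- required `m ∸ k`.
        (sign-between (suc m) (P n Pₙ (suc m)) β (γ k) (suc k) (P-lead (suc m) m<n) β-roots (s≤s (ℕ.<⇒≤ k<m))
          (λ { j (s≤s j≤k) → ≤-<-trans (β≤ j≤k (s≤s (ℕ.<⇒≤ k<m))) (proj₁ (proj₂ (proj₂ rolle-roots) k k<m)) })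
          (λ j k<j j<m → <-≤-trans (proj₂ (proj₂ (proj₂ rolle-roots) k k<m)) (β≤ k<j j<m)))

    descend-to : ∀ {i} → i ℕ.≤ n → Roots n (P n Pₙ n) → Roots i (P n Pₙ i)
    descend-to i≤n roots = go (ℕ.≤⇒≤‴ i≤n)
      where
      -- `≤‴` unfolds by raising `i`, so the recursion passes from `suc i` to `i`, the direction of
      -- `descend`.
      go : ∀ {i} → i ℕ.≤‴ n → Roots i (P n Pₙ i)
      go ℕ.≤‴-refl          = roots
      go {i} (ℕ.≤‴-step i<‴n) = proj₁ (descend i (ℕ.≤‴⇒≤ i<‴n) (go i<‴n))

    negate : ∀ {y} → 0# < - 1# * y → y < 0#
    negate {y} 0<-y = pos-neg (<-respʳ-≈ (-1* y) 0<-y)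
      where
      -1* : ∀ y → - 1# * y ≈ - y
      -1* = solve 1 (λ y → :- con (ℤ.+ 1) :* y := :- y) refl

    negate⁻ : ∀ {y} → y < 0# → 0# < - 1# * y
    negate⁻ {y} y<0 = <-respʳ-≈ (-1* y) (neg-pos y<0)
      where
      -1* : ∀ y → - y ≈ - 1# * y
      -1* = solve 1 (λ y → :- y := :- con (ℤ.+ 1) :* y) refl

    sign₁⇒a<0 : SignCondition 1 → coeff Pₙ (n ∸ 2) < 0#
    sign₁⇒a<0 sign = pos-neg (*-cancelˡ-pos (proj₁ (proj₂ P₂[0]≈)) (<-respʳ-≈
      (trans (-‿cong (proj₂ (proj₂ P₂[0]≈))) (sym (x*-y≈-xy _ _)))
      (neg-pos (negate (sign (λ _ → 0#) zero-root 0 (s≤s z≤n))))))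

    a<0⇒sign₁ : coeff Pₙ (n ∸ 2) < 0# → SignCondition 1
    -- Uniqueness of the single root of `P 1` identifies `α 0` with 0.
    a<0⇒sign₁ a<0 α α-roots zero _ = <-respʳ-≈
      (*-congˡ (eval-cong (P n Pₙ 2)
        (roots-unique 1 (P n Pₙ 1) (λ _ → 0#) α (P-lead 1 (ℕ.≤-trans (s≤s z≤n) 3≤n)) zero-root α-roots (s≤s z≤n))))
      (negate⁻ (pos-neg (<-respʳ-≈ (trans (x*-y≈-xy _ _) (-‿cong (sym (proj₂ (proj₂ P₂[0]≈)))))
        (*-pos (proj₁ (proj₂ P₂[0]≈)) (neg-pos a<0)))))
    a<0⇒sign₁ a<0 α α-roots (suc k) (s≤s ())

    b-R⁰ : ∀ j x → eval (P n Pₙ (suc j)) x ≈ 0# →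
      b n Pₙ (suc (suc j)) - eval (R⁰ n Pₙ j) x ≈ eval (P n Pₙ (suc (suc j))) x
    b-R⁰ j x p[x]≈0 = begin
      B - eval (R⁰ n Pₙ j) x
        ≈⟨ +-congˡ (-‿cong (trans (eval-⊕ (R n Pₙ j) (const B) x) (+-congʳ (eval-⊕ (X* p) (map -_ q) x)))) ⟩
      B - (0# + x * eval p x + eval (map -_ q) x + (B + x * 0#))
        ≈⟨ +-congˡ (-‿cong (+-congʳ (+-cong (+-congˡ (*-congˡ p[x]≈0)) (eval-neg q x)))) ⟩
      B - (0# + x * 0# + - eval q x + (B + x * 0#))
        ≈⟨ simplify B x (eval q x) ⟩
      eval q x
        ∎
      where
      open SetoidReasoning setoid
      B = b n Pₙ (suc (suc j))
      p = P n Pₙ (suc j)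
      q = P n Pₙ (suc (suc j))
      simplify : ∀ B x y → B - (0# + x * 0# + - y + (B + x * 0#)) ≈ y
      simplify = solve 3 (λ B x y → B :- (con (ℤ.+ 0) :+ x :* con (ℤ.+ 0) :+ :- y :+ (B :+ x :* con (ℤ.+ 0))) := y) refl

    sign⇒condition : ∀ m → 2 ℕ.≤ m → SignCondition m → Condition n Pₙ (suc m)
    sign⇒condition (suc j) 2≤m sign α α-roots =
      alternating⇒endpoints n Pₙ (suc (suc j)) α (s≤s 2≤m) λ where
        -- Numbering from 1 and from 0 agree in sign because `suc (suc j) ∸ suc k` reduces to
        -- `suc j ∸ k`.
        (suc k) _ (s≤s k<m) → <-respʳ-≈ (*-congˡ (sym (b-R⁰ j (α (suc k)) (proj₁ α-roots (suc k) (s≤s z≤n) k<m))))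
          (sign (α ∘ suc) (ordered⇒increasing (suc j) (P n Pₙ (suc j)) α α-roots) k k<m)

    condition⇒sign : ∀ m → 2 ℕ.≤ m → Condition n Pₙ (suc m) → SignCondition m
    condition⇒sign (suc j) 2≤m condition α α-roots k k<m = <-respʳ-≈
      (*-congˡ (b-R⁰ j (α k) (proj₁ α-roots k<m)))
      (endpoints⇒alternating n Pₙ (suc (suc j)) (cons 0# α) (s≤s 2≤m)
        (condition (cons 0# α) (increasing⇒ordered (suc j) (P n Pₙ (suc j)) α α-roots))
        (suc k) (s≤s z≤n) (s≤s k<m))

    -- The induction starts from the root 0 of `P 1`; the step to `P 2` uses the sign of
    -- `coeff Pₙ (n ∸ 2)`, and every later step uses one `Condition`.
    ascend : ∀ m → m ℕ.< n → coeff Pₙ (n ∸ 2) < 0# →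
      (∀ j → 3 ℕ.≤ j → j ℕ.≤ suc m → Condition n Pₙ j) → Roots (suc m) (P n Pₙ (suc m))
    ascend zero    _   a<0 _          = (λ _ → 0#) , zero-root
    ascend (suc m) m<n a<0 conditions = step
      (ascend m (ℕ.<-trans (ℕ.n<1+n m) m<n) a<0 λ j 3≤j j≤m → conditions j 3≤j (ℕ.m≤n⇒m≤1+n j≤m))
      where
      sign : ∀ m → (∀ j → 3 ℕ.≤ j → j ℕ.≤ suc (suc m) → Condition n Pₙ j) → SignCondition (suc m)
      sign zero    _          = a<0⇒sign₁ a<0
      sign (suc m) conditions = condition⇒sign (suc (suc m)) (s≤s (s≤s z≤n))
        (conditions _ (s≤s (s≤s (s≤s z≤n))) ℕ.≤-refl)
      step : Roots (suc m) (P n Pₙ (suc m)) → Roots (suc (suc m)) (P n Pₙ (suc (suc m)))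
      step (α , α-roots) = roots-from-signs (suc m) (P n Pₙ (suc (suc m))) α (P-lead (suc (suc m)) m<n)
        (proj₂ α-roots) (sign m conditions α α-roots)

    -- `P n` is `Pₙ` scaled by `n! / n!`; positivity of this scalar is enough for the roots to
    -- agree.
    Pₙ-roots⇒ : Roots n Pₙ → Roots n (P n Pₙ n)
    Pₙ-roots⇒ (β , β-roots) = β , roots-⊆ Pₙ (P n Pₙ n) β (λ x p[x]≈0 → scale-root _ (Pₙ ⁽ n ∸ n ⁾)
      (trans (reflexive (≡.cong (λ t → eval (Pₙ ⁽ t ⁾) x) (ℕ.n∸n≡0 n))) p[x]≈0)) β-roots

    Pₙ-roots⇐ : Roots n (P n Pₙ n) → Roots n Pₙ
    Pₙ-roots⇐ (β , β-roots) = β , roots-⊆ (P n Pₙ n) Pₙ β (λ x p[x]≈0 →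
      trans (reflexive (≡.cong (λ t → eval (Pₙ ⁽ t ⁾) x) (≡.sym (ℕ.n∸n≡0 n))))
        (scale-root⁻ (Pₙ ⁽ n ∸ n ⁾) (factor-pos n) p[x]≈0)) β-roots

    distinct⇒sign : HasDistinctRoots n Pₙ → ∀ m → m ℕ.< n → SignCondition m
    distinct⇒sign distinct m m<n =
      proj₂ (descend m m<n (descend-to m<n (Pₙ-roots⇒ (distinct⇒roots n Pₙ distinct))))

    distinct⇒condition : HasDistinctRoots n Pₙ → ∀ i → 3 ℕ.≤ i → i ℕ.≤ n → Condition n Pₙ i
    distinct⇒condition distinct (suc m) (s≤s 2≤m) m<n = sign⇒condition m 2≤m (distinct⇒sign distinct m m<n)

    -- Allowing `i = suc n` lets one statement cover both the roots of `P (i ∸ 1)` to which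
    -- `Condition` at `i` refers and the roots of `P n` itself.
    ascend-all : ∀ i → 3 ℕ.≤ i → i ℕ.≤ suc n → coeff Pₙ (n ∸ 2) < 0# →
      (∀ j → 3 ℕ.≤ j → j ℕ.< i → Condition n Pₙ j) → Roots (i ∸ 1) (P n Pₙ (i ∸ 1))
    ascend-all (suc (suc m)) _ (s≤s m<n) a<0 conditions =
      ascend m m<n a<0 λ j 3≤j j≤m → conditions j 3≤j (s≤s j≤m)
    ascend-all (suc zero) (s≤s ()) _ _ _

theorem2 : ∀ {c ℓ₁ ℓ₂} (ℝ : Reals c ℓ₁ ℓ₂) →
    let open Reals ℝ
        open RealPolynomials ℝ in
    (n : ℕ) → 3 ℕ.≤ n →
    (Pₙ : Poly) → IsMonic n Pₙ → coeff Pₙ (n ∸ 1) ≈ 0# →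
    (HasDistinctRoots n Pₙ ⇔
      (coeff Pₙ (n ∸ 2) < 0# × (∀ i → 3 ℕ.≤ i → i ℕ.≤ n → Condition n Pₙ i)))
    ×
    (∀ i → 3 ℕ.≤ i → i ℕ.≤ n → coeff Pₙ (n ∸ 2) < 0# →
      (∀ j → 3 ℕ.≤ j → j ℕ.< i → Condition n Pₙ j) →
      ∃[ α ] OrderedRoots (i ∸ 1) (P n Pₙ (i ∸ 1)) α)
    ×
    (HasDistinctRoots n Pₙ → ∀ i → 3 ℕ.≤ i → i ℕ.≤ n → NonemptyInterval n Pₙ i)
theorem2 ℝ n 3≤n Pₙ monic a₁≈0 =
  mk⇔
    (λ distinct → sign₁⇒a<0 (distinct⇒sign distinct 1 (ℕ.≤-trans (s≤s (s≤s z≤n)) 3≤n))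
                , distinct⇒condition distinct)
    (λ (a<0 , conditions) → roots⇒distinct n Pₙ (Pₙ-roots⇐
      (ascend-all (suc n) (ℕ.m≤n⇒m≤1+n 3≤n) ℕ.≤-refl a<0 λ j 3≤j j<1+n → conditions j 3≤j (ℕ.≤-pred j<1+n))))
  , (λ i 3≤i i≤n a<0 conditions → let β , β-roots = ascend-all i 3≤i (ℕ.m≤n⇒m≤1+n i≤n) a<0 conditions in
      cons 0# β , increasing⇒ordered (i ∸ 1) (P n Pₙ (i ∸ 1)) β β-roots)
  , λ distinct i 3≤i i≤n α α-roots →
      let even , odd = distinct⇒condition distinct i 3≤i i≤n α α-roots in
      -- The interval is nonempty because `b n Pₙ i` itself lies in it.
      (λ 2∣i → b n Pₙ i , even 2∣i) , (λ 2∤i → b n Pₙ i , odd 2∤i)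
  where
  open Reals ℝ
  open RealPolynomials ℝ
  open Derivatives ℝ
  open RootConstruction ℝ using (cons)
  open Family n 3≤n Pₙ monic a₁≈0
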